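{- Let $n\ge 4$ and let $a,s,b,t$ be four distinct vertices of $K_n$. Orient every edge of $K_n$ independently in one of its two directions, each with probability $1/2$. Let $A$ be the event that there is no directed path from $s$ to $a$, and $B$ the event that there is no directed path from $t$ to $b$. Then $A$ and $B$ are positively correlated, i.e. $\mathbb{P}(A\cap B)>\mathbb{P}(A)\mathbb{P}(B)$. -}

module Defs where

open import Data.Bool using (Bool; true; false)
open import Data.Nat using (ℕ; zero; suc; _^_)
open import Data.Nat.Properties using (m^n≢0)
open import Data.Fin using (Fin; _<?_)
open import Data.List using (List; []; _∷_; length; lookup; filter; concatMap; allFin; map)
open import Data.Vec using (Vec) renaming ([] to []ᵛ; _∷_ to _∷ᵛ_; lookup to lookupᵛ)
open import Data.Product using (_×_; _,_; ∃; proj₁; proj₂)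
open import Data.Sum using (_⊎_)
open import Data.Integer using (+_)
open import Data.Rational using (ℚ; _/_)
open import Relation.Binary.PropositionalEquality using (_≡_)
open import Data.Empty
open import Level using (0ℓ)
open import Relation.Unary using (Pred; Decidable; _∩_)

edges : (n : ℕ) → List (Fin n × Fin n)
edges n = filter (λ e → proj₁ e <? proj₂ e)
                 (concatMap (λ j → map (λ i → (i , j)) (allFin n)) (allFin n))

numEdges : ℕ → ℕ
numEdges n = length (edges n)

-- An orientation of K_n: one bit per edge.  For the k-th edge (i , j)
-- (with i < j), bit true means the edge is directed i → j, false means j → i.
Orientation : ℕ → Set
Orientation n = Vec Bool (numEdges n)

Arc : ∀ {n} → Orientation n → Fin n → Fin n → Set
Arc {n} o u v = ∃ λ (k : Fin (numEdges n)) →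
    (lookup (edges n) k ≡ (u , v) × lookupᵛ o k ≡ true)
  ⊎ (lookup (edges n) k ≡ (v , u) × lookupᵛ o k ≡ false)

data DPath {n : ℕ} (o : Orientation n) : Fin n → Fin n → Set where
  here  : ∀ {u} → DPath o u u
  there : ∀ {u w v} → Arc o u w → DPath o w v → DPath o u v

allVecs : (m : ℕ) → List (Vec Bool m)
allVecs zero    = []ᵛ ∷ []
allVecs (suc m) = concatMap (λ v → (true ∷ᵛ v) ∷ (false ∷ᵛ v) ∷ []) (allVecs m)

orientations : (n : ℕ) → List (Orientation n)
orientations n = allVecs (numEdges n)

-- Probability of an event E under the uniform measure on orientations
-- (each edge oriented independently with prob. 1/2): |E| / 2^(numEdges n).
-- The value depends only on E, not on the chosen decision procedure.
Pr : (n : ℕ) (E : Pred (Orientation n) 0ℓ) → Decidable E → ℚ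
Pr n E E? = (+ length (filter E? (orientations n))) / (2 ^ numEdges n)
  where instance _ = m^n≢0 2 (numEdges n)

NoPath : ∀ {n} → Fin n → Fin n → Pred (Orientation n) 0ℓ
NoPath u v o = DPath o u v → Data.Empty.⊥

{-# OPTIONS --safe #-}
module Submission where

-- Prescribing the directions of e edges has probability (1/2)^e.  Let
-- y = (1/2)^(n-2).
--
-- If s does not reach a, some vertex set containing s but not a has no outgoing
-- arc.  Treating separately the case that s is a sink or a is a source, a union
-- bound over these sets gives
--   P(A) ≤ (y/2) (2 - y + W),   W = Σ (1/2)^(ij) (1 - (1/2)^i) (1 - (1/2)^j),
-- the sum running over the splittings of the n-2 other vertices into parts of
-- sizes i and j; the last two factors say that s is not a sink and a not a
-- source.  Adding one vertex at a time shows W ≤ 2/3.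
--
-- On the other hand A ∩ B holds if {s, t} has no outgoing arc, if s is a sink
-- and b a source, or if t is a sink and a a source.  The last two events exclude
-- each other, so P(A ∩ B) ≥ 2y² - 2y³, which exceeds (y/2)² (8/3 - y)² for
-- 0 < y ≤ 1/4.

open import Defs
open import Data.Nat using (ℕ; _≥_)
open import Data.Fin using (Fin)
open import Data.Rational using (_<_; _*_)
open import Relation.Binary.PropositionalEquality using (_≢_)
open import Relation.Unary using (Decidable; _∩_)

open import Data.Bool using (Bool; true; false; not; _∧_; _∨_; if_then_else_)
import Data.Bool.Properties as Bool
open import Data.Fin as Fin using (zero; suc; _↑ˡ_)
open import Data.Fin.Patterns using (0F; 1F; 2F; 3F; 4F)
import Data.Fin.Properties as Fin
open import Data.Fin.Subset using (Subset; _⊃_; inside)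
open import Data.Fin.Subset.Induction using (⊃-wellFounded; Acc; acc)
open import Data.Integer using () renaming (+_ to int)
import Data.Integer.Solver as ℤ
open import Data.List as List using (List; []; _∷_; length; filter; concatMap; allFin)
open import Data.List.Membership.Propositional using (_∈_)
open import Data.List.Membership.Propositional.Properties
  using (∈-filter⁺; ∈-concatMap⁺; ∈-map⁺; ∈-allFin)
import Data.List.Properties as List
import Data.List.Relation.Unary.Any as Any
open import Data.List.Relation.Unary.Any.Properties using (lookup-index)
open import Data.Nat as ℕ using (zero; suc)
import Data.Nat.ListAction as ListAction
import Data.Nat.ListAction.Properties as ListAction
import Data.Nat.Properties as ℕ
import Data.Nat.Solver as ℕ
open import Data.Product using (_×_; _,_; ∃; proj₁; proj₂)
open import Data.Rational hiding (_≥_)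
open import Data.Rational.Properties
open import Data.Rational.Solver using (module +-*-Solver)
import Data.Rational.Unnormalised as ℚᵘ
import Data.Rational.Unnormalised.Properties as ℚᵘ
open import Data.Sum using (inj₁; inj₂)
open import Data.Unit using (tt)
open import Data.Vec as Vec using (Vec; []; _∷_; lookup; tabulate; zipWith; _[_]≔_)
import Data.Vec.Properties as Vec
open import Data.Vec.Relation.Unary.All using ([]; _∷_)
open import Data.Vec.Relation.Unary.All.Properties using (lookup⁺)
open import Data.Vec.Relation.Unary.Unique.Propositional using (Unique; []; _∷_)
open import Data.Vec.Relation.Unary.Unique.Propositional.Properties using (lookup-injective)
open import Function using (_∘_; id)
open import Level using (0ℓ)
open import Relation.Binary.Definitions using (tri<; tri≈; tri>)
open import Relation.Binary.PropositionalEquality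
open import Relation.Nullary using (Dec; does; yes; no; contradiction)
open import Relation.Nullary.Decidable using (dec-true; dec-false; toWitness; True)
open import Relation.Unary using (Pred)
open import Algebra.Properties.Semiring.Sum ℕ.+-*-semiring

-- Inequalities between rationals and powers of ½.

0≤-* : ∀ {p q} → 0ℚ ≤ p → 0ℚ ≤ q → 0ℚ ≤ p * q
0≤-* {p} {q} 0≤p 0≤q =
  nonNegative⁻¹ (p * q) {{nonNeg*nonNeg⇒nonNeg p {{nonNegative 0≤p}} q {{nonNegative 0≤q}}}}

0<-* : ∀ {p q} → 0ℚ < p → 0ℚ < q → 0ℚ < p * q
0<-* {p} {q} 0<p 0<q =
  positive⁻¹ (p * q) {{pos*pos⇒pos p {{positive 0<p}} q {{positive 0<q}}}}

0≤-+ : ∀ {p q} → 0ℚ ≤ p → 0ℚ ≤ q → 0ℚ ≤ p + q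
0≤-+ 0≤p 0≤q = +-mono-≤ 0≤p 0≤q

-- Reduces an inequality to a polynomial identity for the ring solver, with an explicit nonnegative
-- difference `r`.
≤-by-gap : ∀ {p q} r → 0ℚ ≤ r → p + r ≡ q → p ≤ q
≤-by-gap {p} r 0≤r refl = ≤-trans (≤-reflexive (sym (+-identityʳ p))) (+-monoʳ-≤ p 0≤r)

0≤-gap : ∀ {p q} → p ≤ q → 0ℚ ≤ q - p
0≤-gap {p} {q} p≤q = ≤-trans (≤-reflexive (sym (+-inverseʳ p))) (+-monoˡ-≤ (- p) p≤q)

*-mono-≤ : ∀ {p q r s} → 0ℚ ≤ p → 0ℚ ≤ s → p ≤ q → r ≤ s → p * r ≤ q * s
*-mono-≤ {p} {q} {r} {s} 0≤p 0≤s p≤q r≤s =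
  ≤-trans (*-monoˡ-≤-nonNeg p {{nonNegative 0≤p}} r≤s)
          (*-monoʳ-≤-nonNeg s {{nonNegative 0≤s}} p≤q)

infix 9 ½^_
½^_ : ℕ → ℚ
½^ zero  = 1ℚ
½^ suc n = ½ * ½^ n

½^-+ : ∀ m n → ½^ (m ℕ.+ n) ≡ ½^ m * ½^ n
½^-+ zero    n = sym (*-identityˡ _)
½^-+ (suc m) n = trans (cong (½ *_) (½^-+ m n)) (sym (*-assoc ½ (½^ m) (½^ n)))

0<½^ : ∀ n → 0ℚ < ½^ n
0<½^ zero    = positive⁻¹ 1ℚ
0<½^ (suc n) = 0<-* {½} (toWitness {a? = 0ℚ <? ½} tt) (0<½^ n)

0≤½^ : ∀ n → 0ℚ ≤ ½^ n
0≤½^ n = <⇒≤ (0<½^ n)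

½^≤1 : ∀ n → ½^ n ≤ 1ℚ
½^≤1 zero    = ≤-refl
½^≤1 (suc n) = ≤-trans (*-monoˡ-≤-nonNeg ½ (½^≤1 n)) (≤ᵇ⇒≤ tt)

½^-≤ : ∀ m n → ½^ (m ℕ.+ n) ≤ ½^ m
½^-≤ m n = ≤-trans (≤-reflexive (½^-+ m n))
  (≤-trans (*-monoˡ-≤-nonNeg (½^ m) {{nonNegative (0≤½^ m)}} (½^≤1 n)) (≤-reflexive (*-identityʳ _)))

-- Sums over splittings, and the bound W ≤ 2/3.

-- Sums over the 2^m colourings, i and j being the sizes of the colour classes.
colourings : ℕ → (ℕ → ℕ → ℚ) → ℚ
colourings zero    f = f 0 0
colourings (suc m) f = colourings m (λ i j → f (suc i) j) + colourings m (λ i j → f i (suc j))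

-- The comparison may use `i + j ≡ m`, so factors depending only on the total can later be pulled
-- out as constants.
colourings-mono : ∀ m {f g} → (∀ i j → i ℕ.+ j ≡ m → f i j ≤ g i j) →
                  colourings m f ≤ colourings m g
colourings-mono zero    f≤g = f≤g 0 0 refl
colourings-mono (suc m) f≤g = +-mono-≤
  (colourings-mono m λ i j eq → f≤g (suc i) j (cong suc eq))
  (colourings-mono m λ i j eq → f≤g i (suc j) (trans (ℕ.+-suc i j) (cong suc eq)))

colourings-cong : ∀ m {f g} → (∀ i j → i ℕ.+ j ≡ m → f i j ≡ g i j) →
                  colourings m f ≡ colourings m g
colourings-cong m f≡g = ≤-antisym
  (colourings-mono m λ i j eq → ≤-reflexive (f≡g i j eq))
  (colourings-mono m λ i j eq → ≤-reflexive (sym (f≡g i j eq)))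

colourings-+ : ∀ m f g →
  colourings m (λ i j → f i j + g i j) ≡ colourings m f + colourings m g
colourings-+ zero    f g = refl
colourings-+ (suc m) f g = trans
  (cong₂ _+_ (colourings-+ m _ _) (colourings-+ m _ _))
  (solve 4 (λ a b c d → (a :+ b) :+ (c :+ d) := (a :+ c) :+ (b :+ d)) refl
    (colourings m (λ i j → f (suc i) j)) (colourings m (λ i j → g (suc i) j))
    (colourings m (λ i j → f i (suc j))) (colourings m (λ i j → g i (suc j))))
  where open +-*-Solver

colourings-* : ∀ m c f → colourings m (λ i j → c * f i j) ≡ c * colourings m f
colourings-* zero    c f = refl
colourings-* (suc m) c f = trans
  (cong₂ _+_ (colourings-* m c _) (colourings-* m c _)) (sym (*-distribˡ-+ c _ _))

isZero : ℕ → ℚ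
isZero zero    = 1ℚ
isZero (suc _) = 0ℚ

0≤isZero : ∀ i → 0ℚ ≤ isZero i
0≤isZero zero    = ≤ᵇ⇒≤ tt
0≤isZero (suc _) = ≤-refl

colourings-0 : ∀ m → colourings m (λ _ _ → 0ℚ) ≡ 0ℚ
colourings-0 zero    = refl
colourings-0 (suc m) = cong₂ _+_ (colourings-0 m) (colourings-0 m)

-- Exactly one colouring leaves the first class empty.
colourings-isZeroˡ : ∀ m → colourings m (λ i _ → isZero i) ≡ 1ℚ
colourings-isZeroˡ zero    = refl
colourings-isZeroˡ (suc m) = cong₂ _+_ (colourings-0 m) (colourings-isZeroˡ m)

colourings-isZeroʳ : ∀ m → colourings m (λ _ j → isZero j) ≡ 1ℚ
colourings-isZeroʳ zero    = refl
colourings-isZeroʳ (suc m) = cong₂ _+_ (colourings-isZeroʳ m) (colourings-0 m)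

splitWeight : ℕ → ℕ → ℚ
splitWeight i j = ½^ (i ℕ.* j) * ((1ℚ - ½^ i) * (1ℚ - ½^ j))

splitSum : ℕ → ℚ
splitSum m = colourings m splitWeight

¾ : ℚ
¾ = int 3 / 4

3ℚ : ℚ
3ℚ = int 3 / 1

-- Put a = ½^ i and b = ½^ j with i, j ≥ 1. Adding a vertex in both possible ways multiplies the
-- weight of a splitting by at most (3/2)(a + b), because a, b ≤ ½. Expanding (½ - a)(½ - b) ≥ 0
-- bounds this by 3/4 + 3ab, which depends on i + j alone.
growth : ℕ → ℚ
growth m = ¾ + 3ℚ * ½^ m

splitWeight-extend : ∀ i j →
  splitWeight (suc i) j + splitWeight i (suc j) ≡
  ½^ (i ℕ.* j) * ((½^ j * ((1ℚ - ½ * ½^ i) * (1ℚ - ½^ j))) + (½^ i * ((1ℚ - ½^ i) * (1ℚ - ½ * ½^ j))))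
splitWeight-extend i j = begin
    ½^ (j ℕ.+ i ℕ.* j) * u + ½^ (i ℕ.* suc j) * v
  ≡⟨ cong₂ (λ p q → p * u + q * v) (½^-+ j (i ℕ.* j))
       (trans (cong ½^_ (ℕ.*-suc i j)) (½^-+ i (i ℕ.* j))) ⟩
    (½^ j * ½^ (i ℕ.* j)) * u + (½^ i * ½^ (i ℕ.* j)) * v
  ≡⟨ solve 5 (λ a b q u v → (b :* q) :* u :+ (a :* q) :* v := q :* (b :* u :+ a :* v)) refl
       (½^ i) (½^ j) (½^ (i ℕ.* j)) u v ⟩
    ½^ (i ℕ.* j) * (½^ j * u + ½^ i * v) ∎
  where
  open ≡-Reasoning
  open +-*-Solver
  u = (1ℚ - ½ * ½^ i) * (1ℚ - ½^ j)
  v = (1ℚ - ½^ i) * (1ℚ - ½ * ½^ j)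

-- The isZero terms account for the splittings with an empty part, whose weight
-- vanishes but whose extensions need not have weight 0.  For i, j ≥ 1 the growth
-- factor comes from (½ - ½^ i) * (½ - ½^ j) ≥ 0.
splitWeight-step : ∀ i j →
  splitWeight (suc i) j + splitWeight i (suc j) ≤
  growth (i ℕ.+ j) * splitWeight i j +
  (½ * ½^ (i ℕ.+ j)) * (isZero i + isZero j)
splitWeight-step zero j = ≤-by-gap gap 0≤gap (begin
    (splitWeight 1 j + splitWeight 0 (suc j)) + gap
  ≡⟨ cong (_+ gap) (splitWeight-extend 0 j) ⟩
    _
  ≡⟨ solve 3 (λ b g z → con 1ℚ :* ((b :* ((con 1ℚ :- con ½ :* con 1ℚ) :* (con 1ℚ :- b))) :+
                        (con 1ℚ :* ((con 1ℚ :- con 1ℚ) :* (con 1ℚ :- con ½ :* b))))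
                   :+ (con ½ :* b :* (b :+ z))
                 := g :* (con 1ℚ :* ((con 1ℚ :- con 1ℚ) :* (con 1ℚ :- b)))
                   :+ (con ½ :* b) :* (con 1ℚ :+ z)) refl (½^ j) (growth j) (isZero j) ⟩
    _ ∎)
  where
  open ≡-Reasoning
  open +-*-Solver
  gap = ½ * ½^ j * (½^ j + isZero j)
  0≤gap : 0ℚ ≤ gap
  0≤gap = 0≤-* (0≤½^ (suc j)) (0≤-+ (0≤½^ j) (0≤isZero j))
splitWeight-step (suc i) zero = ≤-by-gap gap 0≤gap (begin
    (splitWeight (2 ℕ.+ i) 0 + splitWeight (suc i) 1) + gap
  ≡⟨ cong (_+ gap) (splitWeight-extend (suc i) 0) ⟩
    ½^ (suc i ℕ.* 0) * ((1ℚ * ((1ℚ - ½ * a) * (1ℚ - 1ℚ))) + (a * ((1ℚ - a) * (1ℚ - ½ * 1ℚ)))) + gap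
  ≡⟨ cong (λ k → ½^ k * ((1ℚ * ((1ℚ - ½ * a) * (1ℚ - 1ℚ))) + (a * ((1ℚ - a) * (1ℚ - ½ * 1ℚ)))) + gap) (ℕ.*-zeroʳ (suc i)) ⟩
    1ℚ * ((1ℚ * ((1ℚ - ½ * a) * (1ℚ - 1ℚ))) + (a * ((1ℚ - a) * (1ℚ - ½ * 1ℚ)))) + gap
  ≡⟨ solve 3 (λ a g q → con 1ℚ :* ((con 1ℚ :* ((con 1ℚ :- con ½ :* a) :* (con 1ℚ :- con 1ℚ))) :+
                        (a :* ((con 1ℚ :- a) :* (con 1ℚ :- con ½ :* con 1ℚ))))
                   :+ (con ½ :* a :* a)
                 := g :* (q :* ((con 1ℚ :- a) :* (con 1ℚ :- con 1ℚ)))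
                   :+ (con ½ :* a) :* (con 0ℚ :+ con 1ℚ)) refl a (growth (suc i)) (½^ (suc i ℕ.* 0)) ⟩
    growth (suc i) * splitWeight (suc i) 0 + (½ * a) * (0ℚ + 1ℚ)
  ≡⟨ cong (λ k → growth k * splitWeight (suc i) 0 + (½ * ½^ k) * (0ℚ + 1ℚ)) (sym (ℕ.+-identityʳ (suc i))) ⟩
    _ ∎)
  where
  open ≡-Reasoning
  open +-*-Solver
  a = ½^ suc i
  gap = ½ * a * a
  0≤gap : 0ℚ ≤ gap
  0≤gap = 0≤-* (0≤½^ (2 ℕ.+ i)) (0≤½^ (suc i))
splitWeight-step (suc i) (suc j) = ≤-by-gap gap 0≤gap (begin
    (splitWeight (2 ℕ.+ i) (suc j) + splitWeight (suc i) (2 ℕ.+ j)) + gap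
  ≡⟨ cong (_+ gap) (splitWeight-extend (suc i) (suc j)) ⟩
    _
  ≡⟨ solve 3 (λ a b q →
       q :* ((b :* ((con 1ℚ :- con ½ :* a) :* (con 1ℚ :- b)))
          :+ (a :* ((con 1ℚ :- a) :* (con 1ℚ :- con ½ :* b))))
       :+ q :* (con 3ℚ :* ((con ½ :- a) :* (con ½ :- b)) :* ((con 1ℚ :- a) :* (con 1ℚ :- b))
          :+ (b :* (con 1ℚ :- b) :* (con ½ :- a) :+ a :* (con 1ℚ :- a) :* (con ½ :- b)))
       := (con ¾ :+ con 3ℚ :* (a :* b)) :* (q :* ((con 1ℚ :- a) :* (con 1ℚ :- b)))
       :+ (con ½ :* (a :* b)) :* (con 0ℚ :+ con 0ℚ)) refl a b q ⟩
    (¾ + 3ℚ * (a * b)) * splitWeight (suc i) (suc j) + (½ * (a * b)) * (0ℚ + 0ℚ)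
  ≡⟨ cong (λ y → (¾ + 3ℚ * y) * splitWeight (suc i) (suc j) + (½ * y) * (0ℚ + 0ℚ))
       (sym (½^-+ (suc i) (suc j))) ⟩
    _ ∎)
  where
  open ≡-Reasoning
  open +-*-Solver
  a = ½^ suc i
  b = ½^ suc j
  q = ½^ (suc i ℕ.* suc j)
  gap = q * (3ℚ * ((½ - a) * (½ - b)) * ((1ℚ - a) * (1ℚ - b))
             + (b * (1ℚ - b) * (½ - a) + a * (1ℚ - a) * (½ - b)))
  0≤½-a = 0≤-gap (½^-≤ 1 i)
  0≤½-b = 0≤-gap (½^-≤ 1 j)
  0≤1-a = 0≤-gap (½^≤1 (suc i))
  0≤1-b = 0≤-gap (½^≤1 (suc j))
  0≤gap : 0ℚ ≤ gap
  0≤gap = 0≤-* (0≤½^ (suc i ℕ.* suc j))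
    (0≤-+ (0≤-* (0≤-* {3ℚ} (≤ᵇ⇒≤ tt) (0≤-* 0≤½-a 0≤½-b)) (0≤-* 0≤1-a 0≤1-b))
          (0≤-+ (0≤-* (0≤-* (0≤½^ (suc j)) 0≤1-b) 0≤½-a)
                (0≤-* (0≤-* (0≤½^ (suc i)) 0≤1-a) 0≤½-b)))

-- The growth factor is constant over the sum, and the two families of splittings with an empty part
-- add half of ½^ m each.
splitSum-step : ∀ m → splitSum (suc m) ≤ growth m * splitSum m + ½^ m
splitSum-step m = begin
    splitSum (suc m)
  ≡⟨ colourings-+ m _ _ ⟨
    colourings m (λ i j → splitWeight (suc i) j + splitWeight i (suc j))
  ≤⟨ colourings-mono m (λ { i j refl → splitWeight-step i j }) ⟩
    colourings m (λ i j → growth m * splitWeight i j + (½ * ½^ m) * (isZero i + isZero j))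
  ≡⟨ colourings-+ m _ _ ⟩
    colourings m (λ i j → growth m * splitWeight i j) +
    colourings m (λ i j → (½ * ½^ m) * (isZero i + isZero j))
  ≡⟨ cong₂ _+_ (colourings-* m (growth m) _) (trans (colourings-* m (½ * ½^ m) _) (cong ((½ * ½^ m) *_)
       (trans (colourings-+ m _ _) (cong₂ _+_ (colourings-isZeroˡ m) (colourings-isZeroʳ m))))) ⟩
    growth m * splitSum m + (½ * ½^ m) * (1ℚ + 1ℚ)
  ≡⟨ cong (growth m * splitSum m +_)
       (solve 1 (λ y → (con ½ :* y) :* (con 1ℚ :+ con 1ℚ) := y) refl (½^ m)) ⟩
    growth m * splitSum m + ½^ m ∎
  where
  open ≤-Reasoning
  open +-*-Solver

⅔ : ℚ
⅔ = int 2 / 3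

splitSum≤⅔ : ∀ m → splitSum m ≤ ⅔
-- The recursion preserves the bound only from m = 5 on, where it gives (27/32)(2/3) + 1/32 = 19/32.
-- At m = 4 it would give 11/16 > 2/3, so the values up to 5 are computed.
splitSum≤⅔ 0 = ≤ᵇ⇒≤ tt
splitSum≤⅔ 1 = ≤ᵇ⇒≤ tt
splitSum≤⅔ 2 = ≤ᵇ⇒≤ tt
splitSum≤⅔ 3 = ≤ᵇ⇒≤ tt
splitSum≤⅔ 4 = ≤ᵇ⇒≤ tt
splitSum≤⅔ 5 = ≤ᵇ⇒≤ tt
splitSum≤⅔ (suc m@(suc (suc (suc (suc (suc k)))))) = begin
    splitSum (suc m)
  ≤⟨ splitSum-step m ⟩
    growth m * splitSum m + ½^ m
  ≤⟨ +-mono-≤ (*-mono-≤ 0≤growth (≤ᵇ⇒≤ tt) growth≤ (splitSum≤⅔ m)) (½^-≤ 5 k) ⟩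
    (¾ + 3ℚ * ½^ 5) * ⅔ + ½^ 5
  ≤⟨ ≤ᵇ⇒≤ tt ⟩
    ⅔ ∎
  where
  open ≤-Reasoning
  0≤growth : 0ℚ ≤ growth m
  0≤growth = 0≤-+ {¾} (≤ᵇ⇒≤ tt) (0≤-* {3ℚ} (≤ᵇ⇒≤ tt) (0≤½^ m))
  growth≤ : growth m ≤ ¾ + 3ℚ * ½^ 5
  growth≤ = +-monoʳ-≤ ¾ (*-monoˡ-≤-nonNeg 3ℚ (½^-≤ 5 k))

-- The final numerical inequality.

square-bound : ∀ {y w} → 0ℚ < y → y ≤ ½^ 2 → w ≤ ⅔ → ∀ {p q} → 0ℚ ≤ p → 
  p ≤ ½ * y * (1ℚ + 1ℚ - y + w) → q ≤ ½ * y * (1ℚ + 1ℚ - y + w) →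
  p * q < (1ℚ + 1ℚ) * (y * y) - (1ℚ + 1ℚ) * (y * (y * y))
square-bound {y} {w} 0<y y≤¼ w≤⅔ {p} {q} 0≤p p≤ q≤ = begin-strict
    p * q
  ≤⟨ *-mono-≤ 0≤p (0≤-* 0≤½y 0≤8/3-y) (≤-trans p≤ relax) (≤-trans q≤ relax) ⟩
    bound * bound
  ≡⟨ +-identityʳ _ ⟨
    bound * bound + 0ℚ
  <⟨ +-monoʳ-< (bound * bound) 0<gap ⟩
    bound * bound + gap
  ≡⟨ solve 1 (λ y → (con ½ :* y :* (con (int 8 / 3) :- y)) :* (con ½ :* y :* (con (int 8 / 3) :- y))
        :+ (con ½ :* y) :* (con ½ :* y) :*
            (con (int 23 / 144) :+ (con (int 35 / 12) :+ y) :* (con (½^ 2) :- y))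
      := con (1ℚ + 1ℚ) :* (y :* y) :- con (1ℚ + 1ℚ) :* (y :* (y :* y))) refl y ⟩
    (1ℚ + 1ℚ) * (y * y) - (1ℚ + 1ℚ) * (y * (y * y)) ∎
  where
  open ≤-Reasoning
  open +-*-Solver
  bound = ½ * y * (int 8 / 3 - y)
  -- After division by (y/2)², the difference is 8(1 - y) - (8/3 - y)². It equals 23/144 at y = 1/4,
  -- and the other summand is its remainder, with the factor 1/4 - y taken out.
  gap = (½ * y) * (½ * y) * (int 23 / 144 + (int 35 / 12 + y) * (½^ 2 - y))
  0<½y : 0ℚ < ½ * y
  0<½y = 0<-* {½} (toWitness {a? = 0ℚ <? ½} tt) 0<y
  0≤½y = <⇒≤ 0<½y
  relax : ½ * y * (1ℚ + 1ℚ - y + w) ≤ bound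
  relax = *-monoˡ-≤-nonNeg (½ * y) {{nonNegative 0≤½y}}
    (≤-by-gap (⅔ - w) (0≤-gap w≤⅔)
      (solve 2 (λ y w → con (1ℚ + 1ℚ) :- y :+ w :+ (con ⅔ :- w) := con (int 8 / 3) :- y) refl y w))
  0≤8/3-y : 0ℚ ≤ int 8 / 3 - y
  0≤8/3-y = 0≤-gap {y} {int 8 / 3} (≤-trans y≤¼ (≤ᵇ⇒≤ tt))
  0<gap : 0ℚ < gap
  0<gap = 0<-* (0<-* 0<½y 0<½y)
    (+-mono-<-≤ {0ℚ} {int 23 / 144} (toWitness {a? = 0ℚ <? int 23 / 144} tt)
      (0≤-* (0≤-+ {int 35 / 12} (≤ᵇ⇒≤ tt) (<⇒≤ 0<y)) (0≤-gap y≤¼)))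

-- Expectation over independent fair bits, and its agreement with `Pr`.

ι : Bool → ℚ
ι true  = 1ℚ
ι false = 0ℚ

0≤ι : ∀ b → 0ℚ ≤ ι b
0≤ι true  = ≤ᵇ⇒≤ tt
0≤ι false = ≤-refl

ι≤1 : ∀ b → ι b ≤ 1ℚ
ι≤1 true  = ≤-refl
ι≤1 false = ≤ᵇ⇒≤ tt

ι-∧ : ∀ x y → ι (x ∧ y) ≡ ι x * ι y
ι-∧ true  y = sym (*-identityˡ (ι y))
ι-∧ false y = sym (*-zeroˡ (ι y))

-- Averaging one bit at a time, instead of summing over `allVecs`, lets linearity and the product
-- formula over edges follow by induction on the bits.
𝔼 : ∀ m → (Vec Bool m → ℚ) → ℚ
𝔼 zero    f = f []
𝔼 (suc m) f = ½ * (𝔼 m (f ∘ (true ∷_)) + 𝔼 m (f ∘ (false ∷_)))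

𝔼-mono : ∀ m {f g} → (∀ v → f v ≤ g v) → 𝔼 m f ≤ 𝔼 m g
𝔼-mono zero    f≤g = f≤g []
𝔼-mono (suc m) f≤g = *-monoˡ-≤-nonNeg ½
  (+-mono-≤ (𝔼-mono m (f≤g ∘ (true ∷_))) (𝔼-mono m (f≤g ∘ (false ∷_))))

𝔼-cong : ∀ m {f g} → (∀ v → f v ≡ g v) → 𝔼 m f ≡ 𝔼 m g
𝔼-cong m f≡g = ≤-antisym (𝔼-mono m (≤-reflexive ∘ f≡g)) (𝔼-mono m (≤-reflexive ∘ sym ∘ f≡g))

𝔼-const : ∀ m c → 𝔼 m (λ _ → c) ≡ c
𝔼-const zero    c = refl
𝔼-const (suc m) c = trans (cong₂ (λ p q → ½ * (p + q)) (𝔼-const m c) (𝔼-const m c))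
  (solve 1 (λ c → con ½ :* (c :+ c) := c) refl c)
  where open +-*-Solver

𝔼-+ : ∀ m f g → 𝔼 m (λ v → f v + g v) ≡ 𝔼 m f + 𝔼 m g
𝔼-+ zero    f g = refl
𝔼-+ (suc m) f g = trans
  (cong₂ (λ p q → ½ * (p + q)) (𝔼-+ m _ _) (𝔼-+ m _ _))
  (solve 4 (λ a b c d → con ½ :* ((a :+ b) :+ (c :+ d))
                     := con ½ :* (a :+ c) :+ con ½ :* (b :+ d)) refl
    (𝔼 m (f ∘ (true ∷_))) (𝔼 m (g ∘ (true ∷_))) (𝔼 m (f ∘ (false ∷_))) (𝔼 m (g ∘ (false ∷_))))
  where open +-*-Solver

𝔼-* : ∀ m c f → 𝔼 m (λ v → c * f v) ≡ c * 𝔼 m f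
𝔼-* zero    c f = refl
𝔼-* (suc m) c f = trans
  (cong₂ (λ p q → ½ * (p + q)) (𝔼-* m c _) (𝔼-* m c _))
  (solve 3 (λ c a b → con ½ :* (c :* a :+ c :* b) := c :* (con ½ :* (a :+ b))) refl
    c (𝔼 m (f ∘ (true ∷_))) (𝔼 m (f ∘ (false ∷_))))
  where open +-*-Solver

𝔼-- : ∀ m f g → 𝔼 m (λ v → f v - g v) ≡ 𝔼 m f - 𝔼 m g
𝔼-- m f g = begin
    𝔼 m (λ v → f v - g v)
  ≡⟨ 𝔼-cong m (λ v → cong (f v +_) (neg-is (g v))) ⟩
    𝔼 m (λ v → f v + (- 1ℚ) * g v)
  ≡⟨ 𝔼-+ m f _ ⟩
    𝔼 m f + 𝔼 m (λ v → (- 1ℚ) * g v)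
  ≡⟨ cong (𝔼 m f +_) (trans (𝔼-* m (- 1ℚ) g) (sym (neg-is (𝔼 m g)))) ⟩
    𝔼 m f - 𝔼 m g ∎
  where
  open ≡-Reasoning
  open +-*-Solver
  neg-is : ∀ p → - p ≡ (- 1ℚ) * p
  neg-is = solve 1 (λ p → :- p := con (- 1ℚ) :* p) refl

-- Since `_/_` reduces fractions, the comparison is made between unnormalised fractions, where it is
-- an identity of integer polynomials.
Pr-halves : ∀ a b d .{{_ : ℕ.NonZero d}} .{{_ : ℕ.NonZero (2 ℕ.* d)}} →
            int (a ℕ.+ b) / (2 ℕ.* d) ≡ ½ * (int a / d + int b / d)
Pr-halves a b (suc d) = toℚᵘ-injective (begin
    toℚᵘ (int (a ℕ.+ b) / (2 ℕ.* suc d))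
  ≈⟨ toℚᵘ-fromℚᵘ (ℚᵘ.mkℚᵘ (int (a ℕ.+ b)) (d ℕ.+ (suc d ℕ.+ 0))) ⟩
    ℚᵘ.mkℚᵘ (int (a ℕ.+ b)) (d ℕ.+ (suc d ℕ.+ 0))
  ≈⟨ ℚᵘ.*≡* (solve 3 (λ a b d → (a :+ b) :* (con (int 2) :* (d :* d))
         := (con (int 1) :* (a :* d :+ b :* d)) :* (d :+ (d :+ con (int 0)))) refl (int a) (int b) (int (suc d))) ⟩
    ℚᵘ.½ ℚᵘ.* (ℚᵘ.mkℚᵘ (int a) d ℚᵘ.+ ℚᵘ.mkℚᵘ (int b) d)
  ≈⟨ ℚᵘ.*-congˡ {ℚᵘ.½} (ℚᵘ.+-cong (toℚᵘ-fromℚᵘ (ℚᵘ.mkℚᵘ (int a) d)) (toℚᵘ-fromℚᵘ (ℚᵘ.mkℚᵘ (int b) d))) ⟨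
    ℚᵘ.½ ℚᵘ.* (toℚᵘ (int a / suc d) ℚᵘ.+ toℚᵘ (int b / suc d))
  ≈⟨ ℚᵘ.*-congˡ {ℚᵘ.½} (toℚᵘ-homo-+ (int a / suc d) (int b / suc d)) ⟨
    toℚᵘ ½ ℚᵘ.* toℚᵘ (int a / suc d + int b / suc d)
  ≈⟨ toℚᵘ-homo-* ½ (int a / suc d + int b / suc d) ⟨
    toℚᵘ (½ * (int a / suc d + int b / suc d)) ∎)
  where
  open ℚᵘ.≃-Reasoning
  open ℤ.+-*-Solver

length-filter-extend : ∀ {m} {P : Pred (Vec Bool (suc m)) 0ℓ} (P? : Decidable P) vs →
  length (filter P? (concatMap (λ v → (true ∷ v) ∷ (false ∷ v) ∷ []) vs)) ≡
  length (filter (P? ∘ (true ∷_)) vs) ℕ.+ length (filter (P? ∘ (false ∷_)) vs)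
length-filter-extend P? [] = refl
length-filter-extend P? (v ∷ vs) with does (P? (true ∷ v))
... | true  with does (P? (false ∷ v))
...   | true  = cong suc (trans (cong suc (length-filter-extend P? vs)) (sym (ℕ.+-suc _ _)))
...   | false = cong suc (length-filter-extend P? vs)
length-filter-extend P? (v ∷ vs) | false with does (P? (false ∷ v))
...   | true  = trans (cong suc (length-filter-extend P? vs)) (sym (ℕ.+-suc _ _))
...   | false = length-filter-extend P? vs

-- Stated for all bit vectors because fixing the first bit leaves an event on shorter vectors, which
-- need not be the orientations of any complete graph.
frequency≡𝔼 : ∀ m {P : Pred (Vec Bool m) 0ℓ} (P? : Decidable P) →
  (int (length (filter P? (allVecs m))) / (2 ℕ.^ m)) {{ℕ.m^n≢0 2 m}} ≡ 𝔼 m (ι ∘ does ∘ P?)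
frequency≡𝔼 zero    P? with does (P? [])
... | true  = refl
... | false = refl
frequency≡𝔼 (suc m) P? = begin
    (int (length (filter P? (allVecs (suc m)))) / (2 ℕ.^ suc m)) {{nz′}}
  ≡⟨ cong (λ k → (int k / (2 ℕ.^ suc m)) {{nz′}}) (length-filter-extend P? (allVecs m)) ⟩
    (int (length (filter (P? ∘ (true ∷_)) (allVecs m)) ℕ.+
          length (filter (P? ∘ (false ∷_)) (allVecs m))) / (2 ℕ.^ suc m)) {{nz′}}
  ≡⟨ Pr-halves (length (filter (P? ∘ (true ∷_)) (allVecs m)))
       (length (filter (P? ∘ (false ∷_)) (allVecs m))) (2 ℕ.^ m) {{nz}} {{nz′}} ⟩
    _
  ≡⟨ cong₂ (λ p q → ½ * (p + q)) (frequency≡𝔼 m (P? ∘ (true ∷_))) (frequency≡𝔼 m (P? ∘ (false ∷_))) ⟩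
    𝔼 (suc m) (ι ∘ does ∘ P?) ∎
  where
  open ≡-Reasoning
  nz = ℕ.m^n≢0 2 m
  nz′ = ℕ.m^n≢0 2 (suc m)

Pr≡𝔼 : ∀ n {P : Pred (Orientation n) 0ℓ} (P? : Decidable P) →
       Pr n P P? ≡ 𝔼 (numEdges n) (ι ∘ does ∘ P?)
Pr≡𝔼 n = frequency≡𝔼 (numEdges n)

-- Probability that all prescribed arcs are present.

-- d i j ≡ true means that the arc i → j is required.
ArcTable : ℕ → Set
ArcTable n = Fin n → Fin n → Bool

Asymmetric : ∀ {n} → ArcTable n → Set
Asymmetric d = ∀ i j → d i j ∧ d j i ≡ false

module _ {n : ℕ} where

  -- Every edge has some direction, so a required arc is present unless its edge is reversed. The
  -- test therefore asks whether the arc opposite to the chosen direction is required.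
  allows : ArcTable n → Fin n × Fin n → Bool → Bool
  allows d (i , j) true  = not (d j i)
  allows d (i , j) false = not (d i j)

  obeys : ArcTable n → (es : List (Fin n × Fin n)) → Vec Bool (length es) → Bool
  obeys d []       []      = true
  obeys d (e ∷ es) (b ∷ v) = allows d e b ∧ obeys d es v

  allows-cong : ∀ {d d′ : ArcTable n} → (∀ i j → d i j ≡ d′ i j) → ∀ e b → allows d e b ≡ allows d′ e b
  allows-cong d≡ (i , j) true  = cong not (d≡ j i)
  allows-cong d≡ (i , j) false = cong not (d≡ i j)

  obeys-cong : ∀ {d d′ : ArcTable n} → (∀ i j → d i j ≡ d′ i j) → ∀ es v → obeys d es v ≡ obeys d′ es v
  obeys-cong d≡ []       []      = refl
  obeys-cong d≡ (e ∷ es) (b ∷ v) = cong₂ _∧_ (allows-cong d≡ e b) (obeys-cong d≡ es v)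

  not-∨ : ∀ x y → not (x ∨ y) ≡ not x ∧ not y
  not-∨ false y = refl
  not-∨ true  y = refl

  allows-∪ : ∀ (d d′ : ArcTable n) e b → allows (λ i j → d i j ∨ d′ i j) e b ≡ allows d e b ∧ allows d′ e b
  allows-∪ d d′ (i , j) true  = not-∨ (d j i) (d′ j i)
  allows-∪ d d′ (i , j) false = not-∨ (d i j) (d′ i j)

  obeys-∪ : ∀ (d d′ : ArcTable n) es v →
            obeys (λ i j → d i j ∨ d′ i j) es v ≡ obeys d es v ∧ obeys d′ es v
  obeys-∪ d d′ []       []      = refl
  obeys-∪ d d′ (e ∷ es) (b ∷ v) = trans
    (cong₂ _∧_ (allows-∪ d d′ e b) (obeys-∪ d d′ es v))
    (interchange (allows d e b) (allows d′ e b) (obeys d es v) (obeys d′ es v))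
    where
    interchange : ∀ w x y z → (w ∧ x) ∧ (y ∧ z) ≡ (w ∧ y) ∧ (x ∧ z)
    interchange false x     y z = refl
    interchange true  false y z = sym (Bool.∧-zeroʳ y)
    interchange true  true  y z = refl

  obeys-lookup : ∀ d es v → obeys d es v ≡ true → ∀ k →
                 allows d (List.lookup es k) (lookup v k) ≡ true
  obeys-lookup d (e ∷ es) (b ∷ v) eq k with allows d e b in ok
  obeys-lookup d (e ∷ es) (b ∷ v) eq zero    | true = ok
  obeys-lookup d (e ∷ es) (b ∷ v) eq (suc k) | true = obeys-lookup d es v eq k

  disobeyed : ∀ d es v → obeys d es v ≡ false →
              ∃ λ k → allows d (List.lookup es k) (lookup v k) ≡ false
  disobeyed d [] [] ()
  disobeyed d (e ∷ es) (b ∷ v) eq with allows d e b in ok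
  ... | false = zero , ok
  ... | true  = let k , bad = disobeyed d es v eq in suc k , bad

  -- A single bit cannot give an edge both directions.
  obeys-∈ : ∀ d es v → obeys d es v ≡ true → ∀ {i j} → (i , j) ∈ es → d i j ∧ d j i ≡ false
  obeys-∈ d es v eq {i} {j} e∈es = go (lookup v k)
      (subst (λ e → allows d e (lookup v k) ≡ true) (sym (lookup-index e∈es)) (obeys-lookup d es v eq k))
    where
    k = Any.index e∈es
    go : ∀ b → allows d (i , j) b ≡ true → d i j ∧ d j i ≡ false
    go true  ok = trans (cong (d i j ∧_) (Bool.not-injective ok)) (Bool.∧-zeroʳ _)
    go false ok = cong (_∧ d j i) (Bool.not-injective ok)

  _#_ : ArcTable n → Fin n × Fin n → ℕ
  d # (i , j) = (if d i j then 1 else 0) ℕ.+ (if d j i then 1 else 0)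

  -- The edges are independent. An edge contributes ½ if one of its directions is required and 1 if
  -- none is; asymmetry rules out a factor 0.
  𝔼-obeys : ∀ {d} → Asymmetric d → ∀ es →
            𝔼 (length es) (ι ∘ obeys d es) ≡ ½^ ListAction.sum (List.map (d #_) es)
  𝔼-obeys asym [] = refl
  𝔼-obeys {d} asym (e@(i , j) ∷ es) = begin
      𝔼 (length (e ∷ es)) (ι ∘ obeys d (e ∷ es))
    ≡⟨ cong₂ (λ p q → ½ * (p + q)) (factor true) (factor false) ⟩
      ½ * (ι (not (d j i)) * rest + ι (not (d i j)) * rest)
    ≡⟨ solve 3 (λ x y r → con ½ :* (x :* r :+ y :* r) := con ½ :* (x :+ y) :* r) refl
         (ι (not (d j i))) (ι (not (d i j))) rest ⟩
      ½ * (ι (not (d j i)) + ι (not (d i j))) * rest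
    ≡⟨ cong₂ _*_ (single (d i j) (d j i) (asym i j)) (𝔼-obeys asym es) ⟩
      ½^ (d # e) * ½^ ListAction.sum (List.map (d #_) es)
    ≡⟨ ½^-+ (d # e) _ ⟨
      ½^ ListAction.sum (List.map (d #_) (e ∷ es)) ∎
    where
    open ≡-Reasoning
    open +-*-Solver
    rest = 𝔼 (length es) (ι ∘ obeys d es)
    factor : ∀ b → 𝔼 (length es) (λ v → ι (allows d e b ∧ obeys d es v)) ≡ ι (allows d e b) * rest
    factor b = trans (𝔼-cong (length es) λ v → ι-∧ (allows d e b) (obeys d es v)) (𝔼-* (length es) (ι (allows d e b)) (ι ∘ obeys d es))
    single : ∀ x y → x ∧ y ≡ false →
      ½ * (ι (not y) + ι (not x)) ≡ ½^ ((if x then 1 else 0) ℕ.+ (if y then 1 else 0))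
    single true  true  ()
    single true  false _ = refl
    single false true  _ = refl
    single false false _ = refl

-- Sums over edges as double sums over vertices.

sum-filter : ∀ {A : Set} {P : Pred A 0ℓ} (P? : Decidable P) (g : A → ℕ) xs →
  ListAction.sum (List.map g (filter P? xs)) ≡ ListAction.sum (List.map (λ x → if does (P? x) then g x else 0) xs)
sum-filter P? g [] = refl
sum-filter P? g (x ∷ xs) with does (P? x)
... | true  = cong (g x ℕ.+_) (sum-filter P? g xs)
... | false = sum-filter P? g xs

sum-concatMap : ∀ {A B : Set} (g : B → ℕ) (f : A → List B) xs →
  ListAction.sum (List.map g (concatMap f xs)) ≡ ListAction.sum (List.map (λ x → ListAction.sum (List.map g (f x))) xs)
sum-concatMap g f [] = refl
sum-concatMap g f (x ∷ xs) = begin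
    ListAction.sum (List.map g (f x List.++ concatMap f xs))
  ≡⟨ cong ListAction.sum (List.map-++ g (f x) _) ⟩
    ListAction.sum (List.map g (f x) List.++ List.map g (concatMap f xs))
  ≡⟨ ListAction.sum-++ (List.map g (f x)) _ ⟩
    ListAction.sum (List.map g (f x)) ℕ.+ ListAction.sum (List.map g (concatMap f xs))
  ≡⟨ cong (ListAction.sum (List.map g (f x)) ℕ.+_) (sum-concatMap g f xs) ⟩
    _ ∎
  where open ≡-Reasoning

sum-tabulate : ∀ {n} (g : Fin n → ℕ) → ListAction.sum (List.tabulate g) ≡ sum g
sum-tabulate {zero}  g = refl
sum-tabulate {suc n} g = cong (g zero ℕ.+_) (sum-tabulate (g ∘ suc))

sum-allFin : ∀ {n} (g : Fin n → ℕ) → ListAction.sum (List.map g (allFin n)) ≡ sum g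
sum-allFin g = trans (cong ListAction.sum (List.map-tabulate id g)) (sum-tabulate g)

-- Every ordered pair of distinct vertices belongs to exactly one edge, and the diagonal contributes
-- nothing.
sum-edges : ∀ {n} (g : Fin n → Fin n → ℕ) → (∀ i → g i i ≡ 0) →
  ListAction.sum (List.map (λ (i , j) → g i j ℕ.+ g j i) (edges n)) ≡ sum λ i → sum λ j → g i j
sum-edges {n} g g-diag = begin
    ListAction.sum (List.map G (edges n))
  ≡⟨ sum-filter (λ e → proj₁ e Fin.<? proj₂ e) G (concatMap row (allFin n)) ⟩
    ListAction.sum (List.map G< (concatMap row (allFin n)))
  ≡⟨ sum-concatMap G< row (allFin n) ⟩
    ListAction.sum (List.map (λ j → ListAction.sum (List.map G< (row j))) (allFin n))
  ≡⟨ sum-allFin (λ j → ListAction.sum (List.map G< (row j))) ⟩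
    sum (λ j → ListAction.sum (List.map G< (row j)))
  ≡⟨ sum-cong-≗ {n} (λ j → trans (cong ListAction.sum (sym (List.map-∘ {g = G<} {f = λ i → i , j} (allFin n))))
                                 (sum-allFin (λ i → G< (i , j)))) ⟩
    sum (λ j → sum (λ i → G< (i , j)))
  ≡⟨ sum-cong-≗ {n} (λ j → trans (sum-cong-≗ {n} (λ i → split (does (i Fin.<? j)) (g i j) (g j i)))
                                 (∑-distrib-+ (λ i → g< i j) (g> j))) ⟩
    sum (λ j → sum (λ i → g< i j) ℕ.+ sum (g> j))
  ≡⟨ ∑-distrib-+ (λ j → sum (λ i → g< i j)) (λ j → sum (g> j)) ⟩
    sum (λ j → sum (λ i → g< i j)) ℕ.+ sum (λ i → sum (g> i))
  -- Only the half `g<` needs its sums exchanged: in the half `g>` the outer index is already the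
  -- first argument of `g`.
  ≡⟨ cong (ℕ._+ sum (λ i → sum (g> i))) (∑-comm g<) ⟨
    sum (λ i → sum (g< i)) ℕ.+ sum (λ i → sum (g> i))
  ≡⟨ ∑-distrib-+ (λ i → sum (g< i)) (λ i → sum (g> i)) ⟨
    sum (λ i → sum (g< i) ℕ.+ sum (g> i))
  ≡⟨ sum-cong-≗ {n} (λ i → trans (sym (∑-distrib-+ (g< i) (g> i))) (sum-cong-≗ {n} (merge i))) ⟩
    sum (λ i → sum (g i)) ∎
  where
  open ≡-Reasoning
  G : Fin n × Fin n → ℕ
  G (i , j) = g i j ℕ.+ g j i
  G< : Fin n × Fin n → ℕ
  G< e = if does (proj₁ e Fin.<? proj₂ e) then G e else 0
  row : Fin n → List (Fin n × Fin n)
  row j = List.map (λ i → i , j) (allFin n)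
  g< g> : Fin n → Fin n → ℕ
  g< i j = if does (i Fin.<? j) then g i j else 0
  g> i j = if does (j Fin.<? i) then g i j else 0
  split : ∀ b x y → (if b then x ℕ.+ y else 0) ≡ (if b then x else 0) ℕ.+ (if b then y else 0)
  split true  x y = refl
  split false x y = refl
  merge : ∀ i j → g< i j ℕ.+ g> i j ≡ g i j
  merge i j with Fin.<-cmp i j
  ... | tri< i<j _ j≮i rewrite dec-true (i Fin.<? j) i<j | dec-false (j Fin.<? i) j≮i = ℕ.+-identityʳ _
  ... | tri≈ i≮j refl _ rewrite dec-false (i Fin.<? i) i≮j = sym (g-diag i)
  ... | tri> i≮j _ j<i rewrite dec-false (i Fin.<? j) i≮j | dec-true (j Fin.<? i) j<i = refl

edge-∈ : ∀ {n} {i j : Fin n} → i Fin.< j → (i , j) ∈ edges n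
edge-∈ {n} {i} {j} i<j = ∈-filter⁺ (λ e → proj₁ e Fin.<? proj₂ e)
  (∈-concatMap⁺ (λ j → List.map (λ i → i , j) (allFin n))
    (Any.map (λ { refl → ∈-map⁺ (_, j) (∈-allFin i) }) (∈-allFin j))) i<j

asymmetric? : ∀ {n} (d : ArcTable n) → Dec (Asymmetric d)
asymmetric? d = Fin.all? λ i → Fin.all? λ j → (d i j ∧ d j i) Bool.≟ false

bit : Bool → ℕ
bit b = if b then 1 else 0

arcCount : ∀ {n} → ArcTable n → ℕ
arcCount d = sum λ i → sum λ j → bit (d i j)

𝔼-obeys-edges : ∀ {n} {d : ArcTable n} → Asymmetric d →
  𝔼 (numEdges n) (ι ∘ obeys d (edges n)) ≡ ½^ arcCount d
𝔼-obeys-edges {n} {d} asym = trans (𝔼-obeys asym (edges n))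
  (cong ½^_ (sum-edges (λ i j → bit (d i j)) λ i →
    cong bit (trans (sym (Bool.∧-idem (d i i))) (asym i i))))

-- Patterns given by vertex classes, and their arc counts.

δ : ∀ {k} → Fin k → Fin k → ℕ
δ x p = bit (does (x Fin.≟ p))

sum-*0 : ∀ {k} (f : Fin k → ℕ) → sum (λ p → f p ℕ.* 0) ≡ 0
sum-*0 {zero}  f = refl
sum-*0 {suc k} f = cong₂ ℕ._+_ (ℕ.*-zeroʳ (f zero)) (sum-*0 (f ∘ suc))

sum-δ : ∀ {k} (f : Fin k → ℕ) x → sum (λ p → f p ℕ.* δ x p) ≡ f x
sum-δ f zero    = trans (cong₂ ℕ._+_ (ℕ.*-identityʳ (f zero)) (sum-*0 (f ∘ suc))) (ℕ.+-identityʳ _)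
sum-δ f (suc x) = cong₂ ℕ._+_ (ℕ.*-zeroʳ (f zero)) (sum-δ (f ∘ suc) x)

classSize : ∀ {k n} → Fin k → Vec (Fin k) n → ℕ
classSize p ρ = sum λ u → δ (lookup ρ u) p

sum-by-class : ∀ {k n} (f : Fin k → ℕ) (ρ : Vec (Fin k) n) →
  sum (λ u → f (lookup ρ u)) ≡ sum (λ p → f p ℕ.* classSize p ρ)
sum-by-class {k} {n} f ρ = begin
    sum (λ u → f (lookup ρ u))
  ≡⟨ sum-cong-≗ {n} (λ u → sum-δ f (lookup ρ u)) ⟨
    sum (λ u → sum (λ p → f p ℕ.* δ (lookup ρ u) p))
  ≡⟨ ∑-comm (λ u p → f p ℕ.* δ (lookup ρ u) p) ⟩
    sum (λ p → sum (λ u → f p ℕ.* δ (lookup ρ u) p))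
  ≡⟨ sum-cong-≗ {k} (λ p → *-distribˡ-sum (f p) (λ u → δ (lookup ρ u) p)) ⟨
    sum (λ p → f p ℕ.* classSize p ρ) ∎
  where open ≡-Reasoning

-- The number of arcs in the blow-up of `G` that replaces each `p` by `size p` vertices. It is a
-- polynomial in the sizes, hence within reach of the ring solver.
weightedArcs : ∀ {k} → ArcTable k → (Fin k → ℕ) → ℕ
weightedArcs G size = sum λ p → sum (λ q → bit (G p q) ℕ.* size q) ℕ.* size p

pullback : ∀ {k n} → Vec (Fin k) n → ArcTable k → ArcTable n
pullback ρ G u v = G (lookup ρ u) (lookup ρ v)

arcCount-pullback : ∀ {k n} (G : ArcTable k) (ρ : Vec (Fin k) n) →
  arcCount (pullback ρ G) ≡ weightedArcs G (λ p → classSize p ρ)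
arcCount-pullback {n = n} G ρ = trans
  (sum-cong-≗ {n} λ u → sum-by-class (bit ∘ G (lookup ρ u)) ρ)
  (sum-by-class (λ p → sum λ q → bit (G p q) ℕ.* classSize q ρ) ρ)

pattern? : ∀ {k n} → ArcTable k → Vec (Fin k) n → Orientation n → Bool
pattern? {n = n} G ρ = obeys (pullback ρ G) (edges n)

𝟙 : ∀ {k n} → ArcTable k → Vec (Fin k) n → Orientation n → ℚ
𝟙 G ρ o = ι (pattern? G ρ o)

-- Asymmetry is decided by evaluation on the small table `G` and passes to the pullback for every
-- `n`.
𝔼-𝟙 : ∀ {k n} (G : ArcTable k) → True (asymmetric? G) → (ρ : Vec (Fin k) n) →
  𝔼 (numEdges n) (𝟙 G ρ) ≡ ½^ weightedArcs G (λ p → classSize p ρ)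
𝔼-𝟙 G asym ρ = trans
  (𝔼-obeys-edges {d = pullback ρ G} λ u v → toWitness asym (lookup ρ u) (lookup ρ v))
  (cong ½^_ (arcCount-pullback G ρ))

_∪_ : ∀ {k} → ArcTable k → ArcTable k → ArcTable k
(G ∪ H) p q = G p q ∨ H p q

-- Uniting requirements intersects events, so a product of indicators is again the indicator of one
-- pattern.
𝟙-∪ : ∀ {k n} (G H : ArcTable k) (ρ : Vec (Fin k) n) o → 𝟙 (G ∪ H) ρ o ≡ 𝟙 G ρ o * 𝟙 H ρ o
𝟙-∪ {n = n} G H ρ o = trans
  (cong ι (obeys-∪ (pullback ρ G) (pullback ρ H) (edges n) o))
  (ι-∧ (pattern? G ρ o) (pattern? H ρ o))

-- Cuts as obstructions to directed paths.

-- All arcs between the two sides point into `z`. For a class `c` of one vertex, `only c` thus makes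
-- this vertex a sink and `allBut c` makes it a source.
cut : ∀ {k} → (Fin k → Bool) → ArcTable k
cut z p q = not (z p) ∧ z q

only allBut : ∀ {k} → Fin k → Fin k → Bool
only   c p = does (p Fin.≟ c)
allBut c p = not (only c p)

obeys-Arc : ∀ {n} {d : ArcTable n} {o u v} → obeys d (edges n) o ≡ true → Arc o u v → d v u ≡ false
obeys-Arc {n} {d} {o} eq (k , inj₁ (e≡ , o≡)) = Bool.not-injective
  (subst₂ (λ e b → allows d e b ≡ true) e≡ o≡ (obeys-lookup d (edges n) o eq k))
obeys-Arc {n} {d} {o} eq (k , inj₂ (e≡ , o≡)) = Bool.not-injective
  (subst₂ (λ e b → allows d e b ≡ true) e≡ o≡ (obeys-lookup d (edges n) o eq k))

disobeyed-Arc : ∀ {n} (d : ArcTable n) o → obeys d (edges n) o ≡ false →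
  ∃ λ u → ∃ λ v → Arc o u v × d v u ≡ true
disobeyed-Arc {n} d o eq with disobeyed d (edges n) o eq
... | k , bad = go (List.lookup (edges n) k) (lookup o k) refl refl bad
  where
  go : ∀ e b → List.lookup (edges n) k ≡ e → lookup o k ≡ b → allows d e b ≡ false →
       ∃ λ u → ∃ λ v → Arc o u v × d v u ≡ true
  go (i , j) true  e≡ o≡ bad = i , j , (k , inj₁ (e≡ , o≡)) , Bool.not-injective bad
  go (i , j) false e≡ o≡ bad = j , i , (k , inj₂ (e≡ , o≡)) , Bool.not-injective bad

-- The first arc of the path to leave `z` would be the reverse of a required one.
cut-closed : ∀ {k n} (z : Fin k → Bool) (ρ : Vec (Fin k) n) {o u v} →
  pattern? (cut z) ρ o ≡ true → DPath o u v → z (lookup ρ u) ≡ true → z (lookup ρ v) ≡ true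
cut-closed z ρ eq here zu = zu
cut-closed z ρ {u = u} eq (there {w = w} arc path) zu =
  cut-closed z ρ eq path (closed (z (lookup ρ u)) (z (lookup ρ w)) zu (obeys-Arc eq arc))
  where
  closed : ∀ x y → x ≡ true → not y ∧ x ≡ false → y ≡ true
  closed true true _ _ = refl

cut-noPath : ∀ {k n} (z : Fin k → Bool) (ρ : Vec (Fin k) n) {o u v} →
  pattern? (cut z) ρ o ≡ true → z (lookup ρ u) ≡ true → z (lookup ρ v) ≡ false → NoPath u v o
cut-noPath z ρ eq zu zv path with () ← trans (sym (cut-closed z ρ eq path zu)) zv

unite-obeyed : ∀ {k n} (G H : ArcTable k) (ρ : Vec (Fin k) n) o →
  pattern? G ρ o ≡ true → pattern? H ρ o ≡ true → pattern? (G ∪ H) ρ o ≡ true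
unite-obeyed {n = n} G H ρ o g h = trans (obeys-∪ (pullback ρ G) (pullback ρ H) (edges n) o) (cong₂ _∧_ g h)

-- Singling out distinguished vertices.

-- Class k consists of the unlisted vertices; the last r classes stay empty.
label : ∀ {n k} r → Vec (Fin n) k → Fin n → Fin (k ℕ.+ suc r)
label r []       u = zero
label r (p ∷ ps) u = if does (u Fin.≟ p) then zero else suc (label r ps u)

label-sound : ∀ {n k} r (ps : Vec (Fin n) k) u i → label r ps u ≡ i ↑ˡ suc r → u ≡ lookup ps i
label-sound r (p ∷ ps) u i       eq with u Fin.≟ p
label-sound r (p ∷ ps) u zero    eq | yes u≡p = u≡p
label-sound r (p ∷ ps) u (suc i) eq | no _    = label-sound r ps u i (Fin.suc-injective eq)

label-lookup : ∀ {n k} r {ps : Vec (Fin n) k} → Unique ps → ∀ i → label r ps (lookup ps i) ≡ i ↑ˡ suc r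
label-lookup r {p ∷ ps} (_ ∷ _)    zero    rewrite dec-true (p Fin.≟ p) refl = refl
label-lookup r {p ∷ ps} (p∉ ∷ uniq) (suc i)
  rewrite dec-false (lookup ps i Fin.≟ p) (lookup⁺ p∉ i ∘ sym) = cong suc (label-lookup r uniq i)

labelling : ∀ {n k} r → Vec (Fin n) k → Vec (Fin (k ℕ.+ suc r)) n
labelling r ps = tabulate (label r ps)

lookup-labelling : ∀ {n k} r {ps : Vec (Fin n) k} → Unique ps → ∀ i →
  lookup (labelling r ps) (lookup ps i) ≡ i ↑ˡ suc r
lookup-labelling r {ps} uniq i = trans (Vec.lookup∘tabulate (label r ps) _) (label-lookup r uniq i)

-- By `label-sound` and `lookup-labelling`, membership in this class means equality with the listed
-- vertex.
classSize-labelled : ∀ {n k} r {ps : Vec (Fin n) k} → Unique ps → ∀ i →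
  classSize (i ↑ˡ suc r) (labelling r ps) ≡ 1
classSize-labelled {n} r {ps} uniq i = trans (sum-cong-≗ {n} same) (sum-δ (λ _ → 1) (lookup ps i))
  where
  same : ∀ u → δ (lookup (labelling r ps) u) (i ↑ˡ suc r) ≡ 1 ℕ.* δ (lookup ps i) u
  same u with lookup ps i Fin.≟ u
  ... | yes refl = cong bit (dec-true (_ Fin.≟ _) (lookup-labelling r uniq i))
  ... | no ≢u    = cong bit (dec-false (_ Fin.≟ _) λ eq →
    ≢u (sym (label-sound r ps u i (trans (sym (Vec.lookup∘tabulate (label r ps) u)) eq))))

sum-1 : ∀ n → sum {n} (λ _ → 1) ≡ n
sum-1 zero    = refl
sum-1 (suc n) = cong suc (sum-1 n)

sum-classSize : ∀ {k n} (ρ : Vec (Fin k) n) → sum (λ p → classSize p ρ) ≡ n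
sum-classSize {k} {n} ρ = begin
    sum (λ p → classSize p ρ)
  ≡⟨ sum-cong-≗ {k} (λ p → ℕ.*-identityˡ (classSize p ρ)) ⟨
    sum (λ p → 1 ℕ.* classSize p ρ)
  ≡⟨ sum-by-class (λ _ → 1) ρ ⟨
    sum {n} (λ _ → 1)
  ≡⟨ sum-1 n ⟩
    n ∎
  where open ≡-Reasoning

-- Upper bound for the probability of no path between one pair.

-- Classes for one pair: 0F is a, 1F is s, 3F is the rest of a closed set
-- containing s but not a, and 2F is the rest of its complement.
raise : Fin 4 → Bool → Fin 4
raise 2F true = 3F
raise p  _    = p

-- The sum runs over the subsets of the class `2F` of `β` only. Each candidate closed set thus
-- occurs once, whatever a `Subset` says about vertices outside that class.
∑raise : ∀ {n} → Vec (Fin 4) n → (Vec (Fin 4) n → ℚ) → ℚ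
∑raise []       f = f []
∑raise (2F ∷ β) f = ∑raise β (f ∘ (3F ∷_)) + ∑raise β (f ∘ (2F ∷_))
∑raise (p  ∷ β) f = ∑raise β (f ∘ (p ∷_))

∑raise-cong : ∀ {n} (β : Vec (Fin 4) n) {f g} → (∀ ρ → f ρ ≡ g ρ) → ∑raise β f ≡ ∑raise β g
∑raise-cong []       f≡g = f≡g []
∑raise-cong (0F ∷ β) f≡g = ∑raise-cong β (f≡g ∘ (0F ∷_))
∑raise-cong (1F ∷ β) f≡g = ∑raise-cong β (f≡g ∘ (1F ∷_))
∑raise-cong (2F ∷ β) f≡g = cong₂ _+_ (∑raise-cong β (f≡g ∘ (3F ∷_))) (∑raise-cong β (f≡g ∘ (2F ∷_)))
∑raise-cong (3F ∷ β) f≡g = ∑raise-cong β (f≡g ∘ (3F ∷_))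

0≤∑raise : ∀ {n} (β : Vec (Fin 4) n) {f} → (∀ ρ → 0ℚ ≤ f ρ) → 0ℚ ≤ ∑raise β f
0≤∑raise []       0≤f = 0≤f []
0≤∑raise (0F ∷ β) 0≤f = 0≤∑raise β (0≤f ∘ (0F ∷_))
0≤∑raise (1F ∷ β) 0≤f = 0≤∑raise β (0≤f ∘ (1F ∷_))
0≤∑raise (2F ∷ β) 0≤f = 0≤-+ (0≤∑raise β (0≤f ∘ (3F ∷_))) (0≤∑raise β (0≤f ∘ (2F ∷_)))
0≤∑raise (3F ∷ β) 0≤f = 0≤∑raise β (0≤f ∘ (3F ∷_))

term≤∑raise : ∀ {n} (β : Vec (Fin 4) n) {f} → (∀ ρ → 0ℚ ≤ f ρ) → ∀ X →
              f (zipWith raise β X) ≤ ∑raise β f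
term≤∑raise []       0≤f []      = ≤-refl
term≤∑raise (0F ∷ β) 0≤f (_ ∷ X) = term≤∑raise β (0≤f ∘ (0F ∷_)) X
term≤∑raise (1F ∷ β) 0≤f (_ ∷ X) = term≤∑raise β (0≤f ∘ (1F ∷_)) X
term≤∑raise (2F ∷ β) 0≤f (true ∷ X) =
  ≤-trans (≤-reflexive (sym (+-identityʳ _)))
    (+-mono-≤ (term≤∑raise β (0≤f ∘ (3F ∷_)) X) (0≤∑raise β (0≤f ∘ (2F ∷_))))
term≤∑raise (2F ∷ β) 0≤f (false ∷ X) =
  ≤-trans (≤-reflexive (sym (+-identityˡ _)))
    (+-mono-≤ (0≤∑raise β (0≤f ∘ (3F ∷_))) (term≤∑raise β (0≤f ∘ (2F ∷_)) X))
term≤∑raise (3F ∷ β) 0≤f (_ ∷ X) = term≤∑raise β (0≤f ∘ (3F ∷_)) X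

𝔼-∑raise : ∀ m {n} (β : Vec (Fin 4) n) (f : Vec (Fin 4) n → Vec Bool m → ℚ) →
  𝔼 m (λ v → ∑raise β (λ ρ → f ρ v)) ≡ ∑raise β (λ ρ → 𝔼 m (f ρ))
𝔼-∑raise m []       f = refl
𝔼-∑raise m (0F ∷ β) f = 𝔼-∑raise m β (f ∘ (0F ∷_))
𝔼-∑raise m (1F ∷ β) f = 𝔼-∑raise m β (f ∘ (1F ∷_))
𝔼-∑raise m (2F ∷ β) f = trans (𝔼-+ m _ _)
  (cong₂ _+_ (𝔼-∑raise m β (f ∘ (3F ∷_))) (𝔼-∑raise m β (f ∘ (2F ∷_))))
𝔼-∑raise m (3F ∷ β) f = 𝔼-∑raise m β (f ∘ (3F ∷_))

-- Raising or keeping the vertices of `2F` is a 2-colouring of that class, with i raised and j kept.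
-- The other classes of `β` only shift the arguments of `f`.
∑raise-classSize : ∀ {n} (β : Vec (Fin 4) n) (f : ℕ → ℕ → ℕ → ℕ → ℚ) →
  ∑raise β (λ ρ → f (classSize 0F ρ) (classSize 1F ρ) (classSize 2F ρ) (classSize 3F ρ)) ≡
  colourings (classSize 2F β) (λ i j → f (classSize 0F β) (classSize 1F β) j (i ℕ.+ classSize 3F β))
∑raise-classSize []       f = refl
∑raise-classSize (0F ∷ β) f = ∑raise-classSize β (λ w → f (suc w))
∑raise-classSize (1F ∷ β) f = ∑raise-classSize β (λ w x → f w (suc x))
∑raise-classSize (2F ∷ β) f = cong₂ _+_
  (∑raise-classSize β (λ w x y z → f w x y (suc z)))
  (∑raise-classSize β (λ w x y → f w x (suc y)))
∑raise-classSize (3F ∷ β) f = trans (∑raise-classSize β (λ w x y z → f w x y (suc z)))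
  (colourings-cong (classSize 2F β) λ i j _ →
    cong (f (classSize 0F β) (classSize 1F β) j) (sym (ℕ.+-suc i (classSize 3F β))))

high : Fin 4 → Bool
high 0F = false
high 1F = true
high 2F = false
high 3F = true

separate sink₁ source₀ : ArcTable 4
separate = cut high
sink₁    = cut (only 1F)
source₀  = cut (allBut 0F)

size₄ : ℕ → ℕ → ℕ → ℕ → Fin 4 → ℕ
size₄ w x y z = lookup (w ∷ x ∷ y ∷ z ∷ [])

module _ where
  open ℕ.+-*-Solver

  -- Repeats the shape of `weightedArcs` as solver syntax, so that its evaluation unfolds to
  -- `weightedArcs` itself.
  weightedArcsᴾ : ∀ {k v} → ArcTable k → (Fin k → Polynomial v) → Polynomial v
  weightedArcsᴾ {k} G size =
    ∑ᴾ λ p → ∑ᴾ (λ q → con (bit (G p q)) :* size q) :* size p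
    where
    ∑ᴾ : ∀ {m v} → (Fin m → Polynomial v) → Polynomial v
    ∑ᴾ {zero}  f = con 0
    ∑ᴾ {suc m} f = f zero :+ ∑ᴾ (f ∘ suc)

  size₄ᴾ : ∀ {v} → Polynomial v → Polynomial v → Fin 4 → Polynomial v
  size₄ᴾ j i = lookup (con 1 ∷ con 1 ∷ j ∷ i ∷ [])

  -- The sides have 1 + i and 1 + j vertices. Their product is written so that the factor for i + j
  -- splits off.
  arcs-separate : ∀ i j → weightedArcs separate (size₄ 1 1 j i) ≡ suc ((i ℕ.+ j) ℕ.+ i ℕ.* j)
  arcs-separate = solve 2 (λ i j → weightedArcsᴾ separate (size₄ᴾ j i)
    := con 1 :+ ((i :+ j) :+ i :* j)) refl

  -- The cut already directs the arcs between s and the other side, so only the i arcs inside the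
  -- closed set are new. For a as a source it is the j arcs inside the complement.
  arcs-separate-sink : ∀ i j → weightedArcs (separate ∪ sink₁) (size₄ 1 1 j i) ≡
                       i ℕ.+ suc ((i ℕ.+ j) ℕ.+ i ℕ.* j)
  arcs-separate-sink = solve 2 (λ i j → weightedArcsᴾ (separate ∪ sink₁) (size₄ᴾ j i)
    := i :+ (con 1 :+ ((i :+ j) :+ i :* j))) refl

  arcs-separate-source : ∀ i j → weightedArcs (separate ∪ source₀) (size₄ 1 1 j i) ≡
                         j ℕ.+ suc ((i ℕ.+ j) ℕ.+ i ℕ.* j)
  arcs-separate-source = solve 2 (λ i j → weightedArcsᴾ (separate ∪ source₀) (size₄ᴾ j i)
    := j :+ (con 1 :+ ((i :+ j) :+ i :* j))) refl

  arcs-separate-both : ∀ i j → weightedArcs (separate ∪ (sink₁ ∪ source₀)) (size₄ 1 1 j i) ≡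
                       i ℕ.+ (j ℕ.+ suc ((i ℕ.+ j) ℕ.+ i ℕ.* j))
  arcs-separate-both = solve 2 (λ i j → weightedArcsᴾ (separate ∪ (sink₁ ∪ source₀)) (size₄ᴾ j i)
    := i :+ (j :+ (con 1 :+ ((i :+ j) :+ i :* j)))) refl

  arcs-sink : ∀ m → weightedArcs sink₁ (size₄ 1 1 m 0) ≡ suc m
  arcs-sink = solve 1 (λ m → weightedArcsᴾ sink₁ (size₄ᴾ m (con 0)) := con 1 :+ m) refl

  arcs-source : ∀ m → weightedArcs source₀ (size₄ 1 1 m 0) ≡ suc m
  arcs-source = solve 1 (λ m → weightedArcsᴾ source₀ (size₄ᴾ m (con 0)) := con 1 :+ m) refl

  -- The two requirements share the arc from a to s.
  arcs-sink-source : ∀ m → weightedArcs (sink₁ ∪ source₀) (size₄ 1 1 m 0) ≡ suc (m ℕ.+ m)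
  arcs-sink-source = solve 1 (λ m → weightedArcsᴾ (sink₁ ∪ source₀) (size₄ᴾ m (con 0))
    := con 1 :+ (m :+ m)) refl

snoc : ∀ {n} (o : Orientation n) {u v w} → DPath {n} o u v → Arc {n} o v w → DPath {n} o u w
snoc o here             arc = there arc here
snoc o (there arc′ path) arc = there arc′ (snoc o path arc)

module NoPathBound {n} (s a : Fin n) (a≢s : a ≢ s) where

  uniq : Unique (a ∷ s ∷ [])
  uniq = (a≢s ∷ []) ∷ [] ∷ []

  β : Vec (Fin 4) n
  β = labelling 1 (a ∷ s ∷ [])

  class : Subset n → Vec (Fin 4) n
  class X = zipWith raise β X

  lookup-class : ∀ X u → lookup (class X) u ≡ raise (lookup β u) (lookup X u)
  lookup-class X u = Vec.lookup-zipWith raise u β X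

  β-never-3 : ∀ u → lookup β u ≢ 3F
  β-never-3 u eq with u Fin.≟ a | u Fin.≟ s | trans (sym (Vec.lookup∘tabulate (label 1 (a ∷ s ∷ [])) u)) eq
  ... | yes _ | _     | ()
  ... | no _  | yes _ | ()
  ... | no _  | no _  | ()

  label-u : ∀ u i → lookup β u ≡ i ↑ˡ 2 → u ≡ lookup (a ∷ s ∷ []) i
  label-u u i eq = label-sound 1 (a ∷ s ∷ []) u i (trans (sym (Vec.lookup∘tabulate _ u)) eq)

  Reached : Orientation n → Subset n → Set
  Reached o X = ∀ u → lookup X u ≡ true → DPath o s u

  -- Enlarging a reachable set along a violated cut arc must stop before a.
  closedSet : ∀ {o} → NoPath s a o → ∀ X → Acc _⊃_ X → Reached o X →
              ∃ λ Y → pattern? separate (class Y) o ≡ true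
  closedSet {o} noPath X (acc rec) reached with pattern? separate (class X) o in eq
  ... | true  = X , eq
  ... | false with disobeyed-Arc (pullback (class X) separate) o eq
  ...   | u , v , arc , bad = extend (lookup β v) refl (lookup X v) refl
    where
    split : ∀ x y → not x ∧ y ≡ true → x ≡ false × y ≡ true
    split false true _ = refl , refl
    v-low : high (lookup (class X) v) ≡ false
    v-low = proj₁ (split _ _ bad)
    u-high : high (lookup (class X) u) ≡ true
    u-high = proj₂ (split (high (lookup (class X) v)) _ bad)
    -- The violated arc leads from the high vertex u to the low vertex v. As u is s or lies in X, it
    -- has been reached.
    toU : ∀ c x → lookup β u ≡ c → lookup X u ≡ x → high (raise c x) ≡ true → DPath o s u
    toU 1F x βu _ _ = subst (DPath o s) (sym (label-u u 1F βu)) here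
    toU 2F true _ Xu _ = reached u Xu
    toU 3F x βu _ _ = contradiction βu (β-never-3 u)
    s→v : DPath o s v
    s→v = snoc o (toU _ _ refl refl (trans (cong high (sym (lookup-class X u))) u-high)) arc
    v-low′ : ∀ {c x} → lookup β v ≡ c → lookup X v ≡ x → high (raise c x) ≡ false
    v-low′ refl refl = trans (cong high (sym (lookup-class X v))) v-low
    X′ = X [ v ]≔ inside
    -- Only an unraised vertex of `2F` remains possible for v: s and raised vertices are high, and
    -- reaching a contradicts `noPath`.
    extend : ∀ c → lookup β v ≡ c → ∀ x → lookup X v ≡ x → ∃ λ Y → pattern? separate (class Y) o ≡ true
    extend 0F βv _ _ = contradiction (subst (DPath o s) (label-u v 0F βv) s→v) noPath
    extend 1F βv x Xv with () ← v-low′ βv Xv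
    extend 3F βv _ _ = contradiction βv (β-never-3 v)
    extend 2F βv true Xv with () ← v-low′ βv Xv
    extend 2F βv false Xv = closedSet noPath X′ (rec X′⊃X) reached′
      where
      X′⊃X : X′ ⊃ X
      X′⊃X = (λ {u} u∈X → Vec.lookup⇒[]= u X′ (keep u (Vec.[]=⇒lookup u∈X))) ,
             v , Vec.lookup⇒[]= v X′ (Vec.lookup∘update v X inside) ,
             λ v∈X → contradiction (trans (sym Xv) (Vec.[]=⇒lookup v∈X)) λ ()
        where
        keep : ∀ u → lookup X u ≡ true → lookup X′ u ≡ true
        keep u Xu with u Fin.≟ v
        ... | yes refl = Vec.lookup∘update v X inside
        ... | no u≢v   = trans (Vec.lookup∘update′ u≢v X inside) Xu
      reached′ : Reached o X′
      reached′ u X′u with u Fin.≟ v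
      ... | yes refl = s→v
      ... | no u≢v   = reached u (trans (sym (Vec.lookup∘update′ u≢v X inside)) X′u)

  -- Inclusion-exclusion form of the event that the cut is closed, s is not a sink and a is not a
  -- source. Each summand is the indicator of one pattern, so its expectation is known.
  term : Vec (Fin 4) n → Orientation n → ℚ
  term ρ o = 𝟙 separate ρ o - 𝟙 (separate ∪ sink₁) ρ o
           - 𝟙 (separate ∪ source₀) ρ o + 𝟙 (separate ∪ (sink₁ ∪ source₀)) ρ o

  term-product : ∀ ρ o → term ρ o ≡ 𝟙 separate ρ o * ((1ℚ - 𝟙 sink₁ ρ o) * (1ℚ - 𝟙 source₀ ρ o))
  term-product ρ o
    rewrite 𝟙-∪ separate sink₁ ρ o | 𝟙-∪ separate source₀ ρ o
          | 𝟙-∪ separate (sink₁ ∪ source₀) ρ o | 𝟙-∪ sink₁ source₀ ρ o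
    = solve 3 (λ x y z → x :- x :* y :- x :* z :+ x :* (y :* z)
                      := x :* ((con 1ℚ :- y) :* (con 1ℚ :- z))) refl
        (𝟙 separate ρ o) (𝟙 sink₁ ρ o) (𝟙 source₀ ρ o)
    where open +-*-Solver

  0≤term : ∀ ρ o → 0ℚ ≤ term ρ o
  0≤term ρ o = ≤-trans
    (0≤-* (0≤ι (pattern? separate ρ o))
      (0≤-* (0≤-gap (ι≤1 (pattern? sink₁ ρ o))) (0≤-gap (ι≤1 (pattern? source₀ ρ o)))))
    (≤-reflexive (sym (term-product ρ o)))

  -- Raising only moves vertices from `2F` to `3F`, classes that the sink and source patterns do not
  -- tell apart.
  sink-class : ∀ X o → pattern? sink₁ (class X) o ≡ pattern? sink₁ β o
  sink-class X o = obeys-cong (λ u v → cong₂ (λ x y → not x ∧ y) (same u) (same v)) (edges n) o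
    where
    only-raise : ∀ c x → only 1F (raise c x) ≡ only 1F c
    only-raise 0F x = refl
    only-raise 1F x = refl
    only-raise 2F false = refl
    only-raise 2F true  = refl
    only-raise 3F x = refl
    same : ∀ u → only 1F (lookup (class X) u) ≡ only 1F (lookup β u)
    same u = trans (cong (only 1F) (lookup-class X u)) (only-raise (lookup β u) (lookup X u))

  source-class : ∀ X o → pattern? source₀ (class X) o ≡ pattern? source₀ β o
  source-class X o = obeys-cong (λ u v → cong₂ (λ x y → not x ∧ y) (same u) (same v)) (edges n) o
    where
    allBut-raise : ∀ c x → allBut 0F (raise c x) ≡ allBut 0F c
    allBut-raise 0F x = refl
    allBut-raise 1F x = refl
    allBut-raise 2F false = refl
    allBut-raise 2F true  = refl
    allBut-raise 3F x = refl
    same : ∀ u → allBut 0F (lookup (class X) u) ≡ allBut 0F (lookup β u)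
    same u = trans (cong (allBut 0F) (lookup-class X u)) (allBut-raise (lookup β u) (lookup X u))

  -- The indicator that s is a sink or a is a source, by inclusion-exclusion.
  extreme : Orientation n → ℚ
  extreme o = 𝟙 sink₁ β o + 𝟙 source₀ β o - 𝟙 (sink₁ ∪ source₀) β o

  -- If s is a sink or a is a source, `extreme` is 1. Otherwise, when there is no path, the set
  -- found by `closedSet` makes one `term` equal to 1.
  indicator-bound : (A? : Decidable (NoPath {n} s a)) → ∀ o →
    ι (does (A? o)) ≤ extreme o + ∑raise β (λ ρ → term ρ o)
  indicator-bound A? o rewrite 𝟙-∪ sink₁ source₀ β o
    with pattern? sink₁ β o in sink | pattern? source₀ β o in source
  ... | true  | y     = ≤-trans (ι≤1 (does (A? o)))
        (≤-by-gap (∑raise β (λ ρ → term ρ o)) (0≤∑raise β λ ρ → 0≤term ρ o)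
          (solve 2 (λ y t → con 1ℚ :+ t := con 1ℚ :+ y :- con 1ℚ :* y :+ t) refl (ι y) (∑raise β (λ ρ → term ρ o))))
    where open +-*-Solver
  ... | false | true  = ≤-trans (ι≤1 (does (A? o)))
        (≤-by-gap (∑raise β (λ ρ → term ρ o)) (0≤∑raise β λ ρ → 0≤term ρ o) refl)
  ... | false | false with A? o
  ...   | no _ = ≤-trans (0≤∑raise β λ ρ → 0≤term ρ o) (≤-reflexive (sym (+-identityˡ _)))
  -- The search starts with no raised vertex, where the high side is s alone and the reachability
  -- condition is vacuous.
  ...   | yes noPath with closedSet noPath (Vec.replicate n false) (⊃-wellFounded _)
                          (λ u eq → contradiction (trans (sym (Vec.lookup-replicate u false)) eq) λ ())
  ...     | X , closed = begin
      1ℚ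
    ≡⟨ cong₂ (λ x y → ι x * y) closed (cong₂ (λ x y → (1ℚ - ι x) * (1ℚ - ι y))
         (trans (sink-class X o) sink) (trans (source-class X o) source)) ⟨
      𝟙 separate (class X) o * ((1ℚ - 𝟙 sink₁ (class X) o) * (1ℚ - 𝟙 source₀ (class X) o))
    ≡⟨ term-product (class X) o ⟨
      term (class X) o
    ≤⟨ term≤∑raise β (λ ρ → 0≤term ρ o) X ⟩
      ∑raise β (λ ρ → term ρ o)
    ≡⟨ +-identityˡ _ ⟨
      0ℚ + ∑raise β (λ ρ → term ρ o) ∎
    where open ≤-Reasoning

  𝔼[_] : (Orientation n → ℚ) → ℚ
  𝔼[_] = 𝔼 (numEdges n)

  sizeTerm : ℕ → ℕ → ℕ → ℕ → ℚ
  sizeTerm w x y z = ½^ weightedArcs separate size - ½^ weightedArcs (separate ∪ sink₁) size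
    - ½^ weightedArcs (separate ∪ source₀) size + ½^ weightedArcs (separate ∪ (sink₁ ∪ source₀)) size
    where size = size₄ w x y z

  𝔼-term : ∀ ρ → 𝔼[ term ρ ] ≡ sizeTerm (classSize 0F ρ) (classSize 1F ρ) (classSize 2F ρ) (classSize 3F ρ)
  𝔼-term ρ = begin
      𝔼[ term ρ ]
    ≡⟨ 𝔼-+ N (λ o → x o - y o - z o) w ⟩
      𝔼[ (λ o → x o - y o - z o) ] + 𝔼[ w ]
    ≡⟨ cong (_+ 𝔼[ w ]) (trans (𝔼-- N (λ o → x o - y o) z) (cong (_- 𝔼[ z ]) (𝔼-- N x y))) ⟩
      𝔼[ x ] - 𝔼[ y ] - 𝔼[ z ] + 𝔼[ w ]
    ≡⟨ cong₂ _+_ (cong₂ _-_ (cong₂ _-_ (𝔼-𝟙 separate tt ρ) (𝔼-𝟙 (separate ∪ sink₁) tt ρ))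
         (𝔼-𝟙 (separate ∪ source₀) tt ρ)) (𝔼-𝟙 (separate ∪ (sink₁ ∪ source₀)) tt ρ) ⟩
      sizeTerm (classSize 0F ρ) (classSize 1F ρ) (classSize 2F ρ) (classSize 3F ρ) ∎
    where
    open ≡-Reasoning
    N = numEdges n
    x = 𝟙 separate ρ
    y = 𝟙 (separate ∪ sink₁) ρ
    z = 𝟙 (separate ∪ source₀) ρ
    w = 𝟙 (separate ∪ (sink₁ ∪ source₀)) ρ

  -- If t is the probability of the cut, the four summands are t, ½^ i t, ½^ j t and ½^ i ½^ j t, so
  -- their alternating sum factors.
  sizeTerm-split : ∀ i j → sizeTerm 1 1 j i ≡ (½ * ½^ (i ℕ.+ j)) * splitWeight i j
  sizeTerm-split i j = trans
    (cong₂ _+_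
      (cong₂ _-_ (cong₂ _-_
        (trans (cong ½^_ (arcs-separate i j)) t≡)
        (trans (cong ½^_ (arcs-separate-sink i j)) (times i t≡)))
        (trans (cong ½^_ (arcs-separate-source i j)) (times j t≡)))
      (trans (cong ½^_ (arcs-separate-both i j)) (times i (times j t≡))))
    (solve 4 (λ a b y q → let t = con ½ :* (y :* q) in
        t :- a :* t :- b :* t :+ a :* (b :* t)
        := (con ½ :* y) :* (q :* ((con 1ℚ :- a) :* (con 1ℚ :- b)))) refl
        (½^ i) (½^ j) (½^ (i ℕ.+ j)) (½^ (i ℕ.* j)))
    where
    open +-*-Solver
    t≡ : ½^ suc ((i ℕ.+ j) ℕ.+ i ℕ.* j) ≡ ½ * (½^ (i ℕ.+ j) * ½^ (i ℕ.* j))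
    t≡ = cong (½ *_) (½^-+ (i ℕ.+ j) (i ℕ.* j))
    times : ∀ k {e p} → ½^ e ≡ p → ½^ (k ℕ.+ e) ≡ ½^ k * p
    times k {e} refl = ½^-+ k e

  size-a : classSize 0F β ≡ 1
  size-a = classSize-labelled 1 uniq 0F

  size-s : classSize 1F β ≡ 1
  size-s = classSize-labelled 1 uniq 1F

  size-3 : classSize 3F β ≡ 0
  size-3 = trans (sum-cong-≗ {n} λ u → cong bit (dec-false (lookup β u Fin.≟ 3F) (β-never-3 u)))
                 (sum-*0 {n} (λ _ → 0))

  size-low : 2 ℕ.+ classSize 2F β ≡ n
  size-low = trans (sym (cong₂ ℕ._+_ size-a (cong₂ ℕ._+_ size-s
    (trans (cong (λ k → classSize 2F β ℕ.+ (k ℕ.+ 0)) size-3) (ℕ.+-identityʳ _))))) (sum-classSize β)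

  𝔼-𝟙β : ∀ G → _ → 𝔼[ 𝟙 G β ] ≡ ½^ weightedArcs G (size₄ 1 1 (classSize 2F β) 0)
  𝔼-𝟙β G asym = trans (𝔼-𝟙 G asym β) (cong ½^_ (trans
    (cong₂ (λ w x → weightedArcs G (size₄ w x m (classSize 3F β))) size-a size-s)
    (cong (λ z → weightedArcs G (size₄ 1 1 m z)) size-3)))
    where m = classSize 2F β

  𝔼-extreme : let y = ½^ classSize 2F β in 𝔼[ extreme ] ≡ (½ * y + ½ * y) - ½ * (y * y)
  𝔼-extreme = begin
      𝔼[ extreme ]
    ≡⟨ 𝔼-- N (λ o → 𝟙 sink₁ β o + 𝟙 source₀ β o) (𝟙 (sink₁ ∪ source₀) β) ⟩
      𝔼[ (λ o → 𝟙 sink₁ β o + 𝟙 source₀ β o) ] - 𝔼[ 𝟙 (sink₁ ∪ source₀) β ]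
    ≡⟨ cong (_- 𝔼[ 𝟙 (sink₁ ∪ source₀) β ]) (𝔼-+ N (𝟙 sink₁ β) (𝟙 source₀ β)) ⟩
      (𝔼[ 𝟙 sink₁ β ] + 𝔼[ 𝟙 source₀ β ]) - 𝔼[ 𝟙 (sink₁ ∪ source₀) β ]
    ≡⟨ cong₂ _-_ (cong₂ _+_ (trans (𝔼-𝟙β sink₁ tt) (cong ½^_ (arcs-sink m)))
                             (trans (𝔼-𝟙β source₀ tt) (cong ½^_ (arcs-source m))))
                 (trans (𝔼-𝟙β (sink₁ ∪ source₀) tt) (trans (cong ½^_ (arcs-sink-source m)) (cong (½ *_) (½^-+ m m)))) ⟩
      (½ * ½^ m + ½ * ½^ m) - ½ * (½^ m * ½^ m) ∎
    where
    open ≡-Reasoning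
    N = numEdges n
    m = classSize 2F β

  ∑𝔼-term : let m = classSize 2F β in ∑raise β (λ ρ → 𝔼[ term ρ ]) ≡ (½ * ½^ m) * splitSum m
  ∑𝔼-term = begin
      ∑raise β (λ ρ → 𝔼[ term ρ ])
    ≡⟨ ∑raise-cong β 𝔼-term ⟩
      ∑raise β (λ ρ → sizeTerm (classSize 0F ρ) (classSize 1F ρ) (classSize 2F ρ) (classSize 3F ρ))
    ≡⟨ ∑raise-classSize β sizeTerm ⟩
      colourings m (λ i j → sizeTerm (classSize 0F β) (classSize 1F β) j (i ℕ.+ classSize 3F β))
    ≡⟨ colourings-cong m (λ { i j i+j≡m → trans
         (trans (cong₂ (λ w x → sizeTerm w x j (i ℕ.+ classSize 3F β)) size-a size-s)
                (cong (sizeTerm 1 1 j) (trans (cong (i ℕ.+_) size-3) (ℕ.+-identityʳ i))))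
         (trans (sizeTerm-split i j) (cong (λ k → (½ * ½^ k) * splitWeight i j) i+j≡m)) }) ⟩
      colourings m (λ i j → (½ * ½^ m) * splitWeight i j)
    ≡⟨ colourings-* m (½ * ½^ m) splitWeight ⟩
      (½ * ½^ m) * splitSum m ∎
    where
    open ≡-Reasoning
    m = classSize 2F β

  bound : ℕ → ℚ
  bound m = ½ * ½^ m * (1ℚ + 1ℚ - ½^ m + splitSum m)

  Pr-noPath≤bound : (A? : Decidable (NoPath {n} s a)) → Pr n (NoPath s a) A? ≤ bound (classSize 2F β)
  Pr-noPath≤bound A? = begin
      Pr n (NoPath s a) A?
    ≡⟨ Pr≡𝔼 n A? ⟩
      𝔼[ ι ∘ does ∘ A? ]
    ≤⟨ 𝔼-mono (numEdges n) (indicator-bound A?) ⟩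
      𝔼[ (λ o → extreme o + ∑raise β (λ ρ → term ρ o)) ]
    ≡⟨ 𝔼-+ (numEdges n) extreme _ ⟩
      𝔼[ extreme ] + 𝔼[ (λ o → ∑raise β (λ ρ → term ρ o)) ]
    ≡⟨ cong₂ _+_ 𝔼-extreme (trans (𝔼-∑raise (numEdges n) β term) ∑𝔼-term) ⟩
      (½ * ½^ m + ½ * ½^ m) - ½ * (½^ m * ½^ m) + (½ * ½^ m) * splitSum m
    ≡⟨ solve 2 (λ y w → (con ½ :* y :+ con ½ :* y) :- con ½ :* (y :* y) :+ (con ½ :* y) :* w
          := con ½ :* y :* (con 1ℚ :+ con 1ℚ :- y :+ w)) refl (½^ m) (splitSum m) ⟩
      bound m ∎
    where
    open ≤-Reasoning
    open +-*-Solver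
    m = classSize 2F β

  -- The two pairs have different class vectors; phrasing the bound through n - 2 gives both the
  -- same `m`.
  Pr-noPath≤ : (A? : Decidable (NoPath {n} s a)) → ∀ {m} → 2 ℕ.+ m ≡ n →
    Pr n (NoPath s a) A? ≤ bound m
  Pr-noPath≤ A? {m} 2+m≡n =
    subst (λ k → Pr n (NoPath s a) A? ≤ bound k) (ℕ.+-cancelˡ-≡ 2 _ m (trans size-low (sym 2+m≡n))) (Pr-noPath≤bound A?)

-- Lower bound for the probability that both paths are absent.

-- Classes 0F, 1F, 2F, 3F are a, s, b, t, and 4F is the rest.
startingPair : Fin 5 → Bool
startingPair p = only 1F p ∨ only 3F p

pairClosed sinkSource sinkSource′ : ArcTable 5
pairClosed  = cut startingPair
sinkSource  = cut (only 1F) ∪ cut (allBut 2F)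
sinkSource′ = cut (only 3F) ∪ cut (allBut 0F)

size₅ : ℕ → Fin 5 → ℕ
size₅ q = lookup (1 ∷ 1 ∷ 1 ∷ 1 ∷ q ∷ [])

module _ where
  open ℕ.+-*-Solver

  size₅ᴾ : ∀ {v} → Polynomial v → Fin 5 → Polynomial v
  size₅ᴾ q = lookup (con 1 ∷ con 1 ∷ con 1 ∷ con 1 ∷ q ∷ [])

  arcs-pairClosed : ∀ q → weightedArcs pairClosed (size₅ q) ≡ (2 ℕ.+ q) ℕ.+ (2 ℕ.+ q)
  arcs-pairClosed = solve 1 (λ q → weightedArcsᴾ pairClosed (size₅ᴾ q) := (con 2 :+ q) :+ (con 2 :+ q)) refl

  -- A sink and a source fix n - 1 arcs each and share the arc from b to s.
  arcs-sinkSource : ∀ q → weightedArcs sinkSource (size₅ q) ≡ suc ((2 ℕ.+ q) ℕ.+ (2 ℕ.+ q))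
  arcs-sinkSource = solve 1 (λ q → weightedArcsᴾ sinkSource (size₅ᴾ q)
    := con 1 :+ ((con 2 :+ q) :+ (con 2 :+ q))) refl

  arcs-sinkSource′ : ∀ q → weightedArcs sinkSource′ (size₅ q) ≡ suc ((2 ℕ.+ q) ℕ.+ (2 ℕ.+ q))
  arcs-sinkSource′ = solve 1 (λ q → weightedArcsᴾ sinkSource′ (size₅ᴾ q)
    := con 1 :+ ((con 2 :+ q) :+ (con 2 :+ q))) refl

  -- Beyond the closed pair, the new arcs are the one from t to s and the 1 + q arcs from b to a and
  -- to the rest.
  arcs-pairClosed-sinkSource : ∀ q → weightedArcs (pairClosed ∪ sinkSource) (size₅ q) ≡
                               (2 ℕ.+ q) ℕ.+ ((2 ℕ.+ q) ℕ.+ (2 ℕ.+ q))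
  arcs-pairClosed-sinkSource = solve 1 (λ q → weightedArcsᴾ (pairClosed ∪ sinkSource) (size₅ᴾ q)
    := (con 2 :+ q) :+ ((con 2 :+ q) :+ (con 2 :+ q))) refl

  arcs-pairClosed-sinkSource′ : ∀ q → weightedArcs (pairClosed ∪ sinkSource′) (size₅ q) ≡
                                (2 ℕ.+ q) ℕ.+ ((2 ℕ.+ q) ℕ.+ (2 ℕ.+ q))
  arcs-pairClosed-sinkSource′ = solve 1 (λ q → weightedArcsᴾ (pairClosed ∪ sinkSource′) (size₅ᴾ q)
    := (con 2 :+ q) :+ ((con 2 :+ q) :+ (con 2 :+ q))) refl

-- Any two distinct vertices of the complete graph span an edge, to which `obeys-∈` applies.
adjacent : ∀ {n} {d : ArcTable n} {o} → obeys d (edges n) o ≡ true →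
           ∀ {u v} → u ≢ v → d u v ∧ d v u ≡ false
adjacent {n} {d} {o} eq {u} {v} u≢v with Fin.<-cmp u v
... | tri< u<v _ _ = obeys-∈ d (edges n) o eq (edge-∈ u<v)
... | tri≈ _ u≡v _ = contradiction u≡v u≢v
... | tri> _ _ v<u = trans (Bool.∧-comm (d u v) (d v u)) (obeys-∈ d (edges n) o eq (edge-∈ v<u))

module BothNoPathBound {n} (a s b t : Fin n) (uniq : Unique (a ∷ s ∷ b ∷ t ∷ [])) where

  γ : Vec (Fin 5) n
  γ = labelling 0 (a ∷ s ∷ b ∷ t ∷ [])

  class-of : ∀ i → lookup γ (lookup (a ∷ s ∷ b ∷ t ∷ []) i) ≡ i ↑ˡ 1
  class-of = lookup-labelling 0 uniq

  Both : Orientation n → Set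
  Both = NoPath s a ∩ NoPath t b

  ∪-obeyed : ∀ G H o → pattern? (G ∪ H) γ o ≡ true → pattern? G γ o ≡ true × pattern? H γ o ≡ true
  ∪-obeyed G H o eq = split _ _ (trans (sym (obeys-∪ (pullback γ G) (pullback γ H) (edges n) o)) eq)
    where
    split : ∀ x y → x ∧ y ≡ true → x ≡ true × y ≡ true
    split true true _ = refl , refl

  noPath-by-cut : ∀ z i j {o} → pattern? (cut z) γ o ≡ true → z (i ↑ˡ 1) ≡ true → z (j ↑ˡ 1) ≡ false →
    NoPath (lookup (a ∷ s ∷ b ∷ t ∷ []) i) (lookup (a ∷ s ∷ b ∷ t ∷ []) j) o
  noPath-by-cut z i j eq zi zj =
    cut-noPath z γ eq (trans (cong z (class-of i)) zi) (trans (cong z (class-of j)) zj)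

  pairClosed⇒both : ∀ {o} → pattern? pairClosed γ o ≡ true → Both o
  pairClosed⇒both eq = noPath-by-cut startingPair 1F 0F eq refl refl , noPath-by-cut startingPair 3F 2F eq refl refl

  -- No path leaves the sink s, and none enters the source b.
  sinkSource⇒both : ∀ {o} → pattern? sinkSource γ o ≡ true → Both o
  sinkSource⇒both {o} eq = let sink , source = ∪-obeyed (cut (only 1F)) (cut (allBut 2F)) o eq in
    noPath-by-cut (only 1F) 1F 0F sink refl refl , noPath-by-cut (allBut 2F) 3F 2F source refl refl

  sinkSource′⇒both : ∀ {o} → pattern? sinkSource′ γ o ≡ true → Both o
  sinkSource′⇒both {o} eq = let sink , source = ∪-obeyed (cut (only 3F)) (cut (allBut 0F)) o eq in
    noPath-by-cut (allBut 0F) 1F 0F source refl refl , noPath-by-cut (only 3F) 3F 2F sink refl refl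

  -- s and t cannot both be sinks, since they are adjacent.
  sinkSources-exclusive : ∀ o → pattern? sinkSource γ o ≡ true → pattern? sinkSource′ γ o ≢ true
  sinkSources-exclusive o eq eq′ = contradiction
    (trans (sym (cong₂ (λ p q → G p q ∧ G q p) (class-of 1F) (class-of 3F)))
      (adjacent {d = pullback γ G} (unite-obeyed sinkSource sinkSource′ γ o eq eq′) s≢t))
    (λ ())
    where
    G = sinkSource ∪ sinkSource′
    s≢t : s ≢ t
    s≢t s≡t = contradiction (lookup-injective uniq 1F 3F s≡t) λ ()

  -- Inclusion-exclusion for the union of the three events. By `sinkSources-exclusive`, the only
  -- intersections that can occur are those of `pairClosed` with one of the other two.
  witnesses : Orientation n → ℚ
  witnesses o = 𝟙 pairClosed γ o + (𝟙 sinkSource γ o + 𝟙 sinkSource′ γ o)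
              - (𝟙 (pairClosed ∪ sinkSource) γ o + 𝟙 (pairClosed ∪ sinkSource′) γ o)

  witnesses≤ : (AB? : Decidable Both) → ∀ o → witnesses o ≤ ι (does (AB? o))
  witnesses≤ AB? o rewrite 𝟙-∪ pairClosed sinkSource γ o | 𝟙-∪ pairClosed sinkSource′ γ o
    with pattern? pairClosed γ o in pair | pattern? sinkSource γ o in sb | pattern? sinkSource′ γ o in ta
  -- Once the pair is closed, the other two indicators cancel against their intersections with it.
  ... | true  | x     | y     = ≤-reflexive (trans
        (solve 2 (λ x y → con 1ℚ :+ (x :+ y) :- (con 1ℚ :* x :+ con 1ℚ :* y) := con 1ℚ) refl (ι x) (ι y))
        (sym (cong ι (dec-true (AB? o) (pairClosed⇒both pair)))))
    where open +-*-Solver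
  ... | false | true  | true  = contradiction ta (sinkSources-exclusive o sb)
  ... | false | true  | false = ≤-reflexive (sym (cong ι (dec-true (AB? o) (sinkSource⇒both sb))))
  ... | false | false | true  = ≤-reflexive (sym (cong ι (dec-true (AB? o) (sinkSource′⇒both ta))))
  ... | false | false | false = 0≤ι (does (AB? o))

  others : ℕ
  others = classSize 4F γ

  size-others : 4 ℕ.+ others ≡ n
  size-others = trans (sym (cong₂ ℕ._+_ (size 0F) (cong₂ ℕ._+_ (size 1F) (cong₂ ℕ._+_ (size 2F)
    (cong₂ ℕ._+_ (size 3F) (ℕ.+-identityʳ others)))))) (sum-classSize γ)
    where size = classSize-labelled 0 uniq

  𝔼-𝟙γ : ∀ G → _ → 𝔼 (numEdges n) (𝟙 G γ) ≡ ½^ weightedArcs G (size₅ others)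
  𝔼-𝟙γ G asym = trans (𝔼-𝟙 G asym γ) (cong ½^_ (trans
    (cong₂ (λ w x → weightedArcs G (sizes w x (classSize 2F γ) (classSize 3F γ))) (size 0F) (size 1F))
    (cong₂ (λ y z → weightedArcs G (sizes 1 1 y z)) (size 2F) (size 3F))))
    where
    size = classSize-labelled 0 uniq
    sizes : ℕ → ℕ → ℕ → ℕ → Fin 5 → ℕ
    sizes w x y z = lookup (w ∷ x ∷ y ∷ z ∷ others ∷ [])

  -- The closed pair has probability y², each sink-source event ½ y², and each of the two
  -- intersections y³.
  Pr-both≥ : (AB? : Decidable Both) → let y = ½^ (2 ℕ.+ others) in
    (1ℚ + 1ℚ) * (y * y) - (1ℚ + 1ℚ) * (y * (y * y)) ≤ Pr n Both AB?
  Pr-both≥ AB? = begin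
      (1ℚ + 1ℚ) * (y * y) - (1ℚ + 1ℚ) * (y * (y * y))
    ≡⟨ solve 1 (λ y → con (1ℚ + 1ℚ) :* (y :* y) :- con (1ℚ + 1ℚ) :* (y :* (y :* y))
         := (y :* y) :+ (con ½ :* (y :* y) :+ con ½ :* (y :* y)) :- (y :* (y :* y) :+ y :* (y :* y))) refl y ⟩
      (y * y) + (½ * (y * y) + ½ * (y * y)) - (y * (y * y) + y * (y * y))
    ≡⟨ cong₂ _-_
         (cong₂ _+_ (value pairClosed tt (arcs-pairClosed others) y²)
           (cong₂ _+_ (value sinkSource tt (arcs-sinkSource others) (cong (½ *_) y²))
                      (value sinkSource′ tt (arcs-sinkSource′ others) (cong (½ *_) y²))))
         (cong₂ _+_ (value (pairClosed ∪ sinkSource) tt (arcs-pairClosed-sinkSource others) y³)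
                    (value (pairClosed ∪ sinkSource′) tt (arcs-pairClosed-sinkSource′ others) y³)) ⟨
      𝔼 N p + (𝔼 N q + 𝔼 N r) - (𝔼 N pq + 𝔼 N pr)
    ≡⟨ cong₂ _-_ (trans (𝔼-+ N p _) (cong (𝔼 N p +_) (𝔼-+ N q r))) (𝔼-+ N pq pr) ⟨
      𝔼 N (λ o → p o + (q o + r o)) - 𝔼 N (λ o → pq o + pr o)
    ≡⟨ 𝔼-- N (λ o → p o + (q o + r o)) (λ o → pq o + pr o) ⟨
      𝔼 N witnesses
    ≤⟨ 𝔼-mono N (witnesses≤ AB?) ⟩
      𝔼 N (ι ∘ does ∘ AB?)
    ≡⟨ Pr≡𝔼 n AB? ⟨
      Pr n Both AB? ∎
    where
    open ≤-Reasoning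
    open +-*-Solver
    N = numEdges n
    m = 2 ℕ.+ others
    y = ½^ m
    p = 𝟙 pairClosed γ
    q = 𝟙 sinkSource γ
    r = 𝟙 sinkSource′ γ
    pq = 𝟙 (pairClosed ∪ sinkSource) γ
    pr = 𝟙 (pairClosed ∪ sinkSource′) γ
    y² : ½^ (m ℕ.+ m) ≡ y * y
    y² = ½^-+ m m
    y³ : ½^ (m ℕ.+ (m ℕ.+ m)) ≡ y * (y * y)
    y³ = trans (½^-+ m (m ℕ.+ m)) (cong (y *_) y²)
    value : ∀ G asym {k v} → weightedArcs G (size₅ others) ≡ k → ½^ k ≡ v → 𝔼 N (𝟙 G γ) ≡ v
    value G asym k≡ v≡ = trans (𝔼-𝟙γ G asym) (trans (cong ½^_ k≡) v≡)

-- Comparison of the two bounds.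

0≤Pr : ∀ n {P : Pred (Orientation n) _} (P? : Decidable P) → 0ℚ ≤ Pr n P P?
0≤Pr n P? = begin
    0ℚ
  ≡⟨ 𝔼-const (numEdges n) 0ℚ ⟨
    𝔼 (numEdges n) (λ _ → 0ℚ)
  ≤⟨ 𝔼-mono (numEdges n) (λ o → 0≤ι (does (P? o))) ⟩
    𝔼 (numEdges n) (ι ∘ does ∘ P?)
  ≡⟨ Pr≡𝔼 n P? ⟨
    Pr n _ P? ∎
  where open ≤-Reasoning

theorem2p3 : (n : ℕ) → n ≥ 4 → (a s b t : Fin n) →
    a ≢ s → a ≢ b → a ≢ t → s ≢ b → s ≢ t → b ≢ t →
    (A? : Decidable (NoPath {n} s a)) →
    (B? : Decidable (NoPath {n} t b)) →
    (AB? : Decidable (NoPath {n} s a ∩ NoPath {n} t b)) →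
    Pr n (NoPath s a) A? * Pr n (NoPath t b) B? < Pr n (NoPath s a ∩ NoPath t b) AB?
theorem2p3 n _ a s b t a≢s a≢b a≢t s≢b s≢t b≢t A? B? AB? =
  <-≤-trans
    -- Here `m` is n - 2. The four distinguished vertices are counted apart from `others`, so `m` is
    -- at least 2 and ½^ m ≤ 1/4.
    (square-bound (0<½^ m) (½^-≤ 2 others) (splitSum≤⅔ m) (0≤Pr n A?)
      (NoPathBound.Pr-noPath≤ s a a≢s A? size-others)
      (NoPathBound.Pr-noPath≤ t b b≢t B? size-others))
    (Pr-both≥ AB?)
  where
  open BothNoPathBound a s b t
    ((a≢s ∷ a≢b ∷ a≢t ∷ []) ∷ (s≢b ∷ s≢t ∷ []) ∷ (b≢t ∷ []) ∷ [] ∷ [])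
  m = 2 ℕ.+ others
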